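{- Let $d > 1$ be an integer and $p$ a prime. Consider the game in which Nora and Wanda choose the coefficients of a degree $d$ polynomial from $\mathbb{Q}$, and Wanda wins if and only if the final polynomial has a root in $D_2$, where $D_2$ is any (unital) subring of $\mathbb{Q}_p$, the field of $p$-adic numbers. Then the player who makes the last move has a winning strategy.
   Context: The game: Nora and Wanda alternately choose coefficients of a polynomial $f(x) = a_d x^d + \cdots + a_1 x + a_0$; on each move the current player picks a not-yet-chosen coefficient $a_i$ and assigns it a value in $\mathbb{Q}$, subject to $a_d \neq 0$ and $a_0 \neq 0$. After all $d+1$ coefficients are chosen, Wanda wins if $f$ has a root in $D_2$, and Nora wins otherwise. Who moves first is fixed in advance, which determines who makes the last move; "the player who makes the last move has a winning strategy" is asserted for either such assignment. -}

module Defs where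

open import Algebra.Bundles using (CommutativeRing; Semiring)
import Algebra.Definitions.RawSemiring as RawSemiringDefinitions
open import Data.Fin.Base using (Fin; zero; fromℕ; toℕ)
open import Data.Integer.Base as ℤ using (ℤ; +_)
import Data.Integer.Properties as ℤP
open import Data.Maybe.Base using (Maybe; just; nothing)
open import Data.Nat.Base as ℕ using (ℕ; zero; suc; _≤_; _⊔_)
open import Data.Nat.Divisibility using (_∣_; _∤_; _∣?_; divides; ∣1⇒≡1)
open import Data.Nat.Induction using (<-wellFounded)
import Data.Nat.Properties as ℕP
open import Data.Nat.Primality using (Prime; euclidsLemma; prime⇒nonTrivial)
open import Data.Product.Base using (∃; ∃₂; _×_; _,_)
open import Data.Rational.Base as ℚ using (ℚ; mkℚ; 0ℚ; 1ℚ; ↥_; ↧ₙ_)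
open import Data.Rational.Literals using (fromℤ)
import Data.Rational.Properties as ℚP
open import Data.Rational.Solver using (module +-*-Solver)
import Data.Rational.Unnormalised.Base as ℚᵘ
import Data.Rational.Unnormalised.Properties as ℚᵘP
open import Data.Sum.Base using (_⊎_; [_,_]′)
open import Data.Unit.Base using (⊤)
open import Data.Vec.Base using (Vec; lookup; map; replicate; _[_]≔_)
open import Induction.WellFounded using (Acc; acc)
open import Level using (Level; 0ℓ) renaming (suc to lsuc; _⊔_ to _⊔ˡ_)
open import Relation.Binary.PropositionalEquality
  using (_≡_; _≢_; refl; sym; trans; cong; cong₂; subst; module ≡-Reasoning)
open import Relation.Nullary.Decidable using (yes; no)
open import Relation.Nullary.Negation using (¬_)
open import Relation.Unary using (Pred)

fromℤ-+ : ∀ a b → fromℤ (a ℤ.+ b) ≡ fromℤ a ℚ.+ fromℤ b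
fromℤ-+ a b = ℚP.toℚᵘ-injective (ℚᵘP.≃-trans
  (ℚᵘ.*≡* (cong (ℤ._* + 1) (cong₂ ℤ._+_ (sym (ℤP.*-identityʳ a)) (sym (ℤP.*-identityʳ b)))))
  (ℚᵘP.≃-sym (ℚP.toℚᵘ-homo-+ (fromℤ a) (fromℤ b))))

fromℤ-* : ∀ a b → fromℤ (a ℤ.* b) ≡ fromℤ a ℚ.* fromℤ b
fromℤ-* a b = ℚP.toℚᵘ-injective (ℚᵘP.≃-trans
  (ℚᵘ.*≡* refl)
  (ℚᵘP.≃-sym (ℚP.toℚᵘ-homo-* (fromℤ a) (fromℤ b))))

fromℤ-neg : ∀ a → fromℤ (ℤ.- a) ≡ ℚ.- fromℤ a
fromℤ-neg a = ℚP.toℚᵘ-injective (ℚᵘP.≃-trans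
  (ℚᵘ.*≡* refl)
  (ℚᵘP.≃-sym (ℚP.toℚᵘ-homo‿- (fromℤ a))))

fromℕℚ : ℕ → ℚ
fromℕℚ n = fromℤ (+ n)

fromℕℚ-* : ∀ a b → fromℕℚ (a ℕ.* b) ≡ fromℕℚ a ℚ.* fromℕℚ b
fromℕℚ-* a b = trans (cong fromℤ (ℤP.pos-* a b)) (fromℤ-* (+ a) (+ b))

clear-denominator : ∀ x → x ℚ.* fromℕℚ (↧ₙ x) ≡ fromℤ (↥ x)
clear-denominator x@(mkℚ n d-1 _) = ℚP.toℚᵘ-injective (ℚᵘP.≃-trans
  (ℚP.toℚᵘ-homo-* x (fromℕℚ (suc d-1)))
  (ℚᵘ.*≡* (trans (ℤP.*-identityʳ _)
    (cong (λ k → n ℤ.* + suc k) (sym (ℕP.*-identityʳ d-1))))))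

------------------------------------------------------------------------
-- The p-adic numbers: Cauchy sequences of rationals for the p-adic
-- absolute value, with equality "the difference tends to zero".

module Padic {p : ℕ} (isPrime : Prime p) where

  pow : ℕ → ℚ
  pow k = fromℕℚ (p ℕ.^ k)

  infix 4 _≤ᵛ_

  -- k ≤ᵛ x says v_p(x) ≥ k, i.e. |x|_p ≤ p^(-k): x is p^k times a
  -- rational whose denominator is prime to p.
  record _≤ᵛ_ (k : ℕ) (x : ℚ) : Set where
    constructor mk≤ᵛ
    field
      num      : ℤ
      den      : ℕ
      p∤den    : p ∤ den
      equation : x ℚ.* fromℕℚ den ≡ pow k ℚ.* fromℤ num

  Null : Pred (ℕ → ℚ) 0ℓ
  Null s = ∀ k → ∃ λ N → ∀ n → N ≤ n → k ≤ᵛ s n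

  Cauchy : Pred (ℕ → ℚ) 0ℓ
  Cauchy s = ∀ k → ∃ λ N → ∀ m n → N ≤ m → N ≤ n → k ≤ᵛ s m ℚ.- s n

  record ℚₚ : Set where
    constructor mkℚₚ
    field
      seq    : ℕ → ℚ
      cauchy : Cauchy seq

  open ℚₚ public

  infix 4 _≈_

  record _≈_ (x y : ℚₚ) : Set where
    constructor mk≈
    field
      null : Null (λ n → seq x n ℚ.- seq y n)

  open _≈_ public

  pow-+ : ∀ k l → pow (k ℕ.+ l) ≡ pow k ℚ.* pow l
  pow-+ k l = trans (cong fromℕℚ (ℕP.^-distribˡ-+-* p k l)) (fromℕℚ-* (p ℕ.^ k) (p ℕ.^ l))

  p∤1 : p ∤ 1
  p∤1 p∣1 = ℕ.nonTrivial⇒≢1 {{prime⇒nonTrivial isPrime}} (∣1⇒≡1 p∣1)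

  p∤* : ∀ {a b} → p ∤ a → p ∤ b → p ∤ a ℕ.* b
  p∤* p∤a p∤b p∣ab = [ p∤a , p∤b ]′ (euclidsLemma _ _ isPrime p∣ab)

  ≤ᵛ-0 : ∀ k → k ≤ᵛ 0ℚ
  ≤ᵛ-0 k = mk≤ᵛ (+ 0) 1 p∤1 (sym (ℚP.*-zeroʳ (pow k)))

  ≤ᵛ-+ : ∀ {k x y} → k ≤ᵛ x → k ≤ᵛ y → k ≤ᵛ x ℚ.+ y
  ≤ᵛ-+ {k} {x} {y} (mk≤ᵛ a d p∤d eq) (mk≤ᵛ b e p∤e eq′) =
    mk≤ᵛ (a ℤ.* + e ℤ.+ b ℤ.* + d) (d ℕ.* e) (p∤* p∤d p∤e) (begin
      (x ℚ.+ y) ℚ.* fromℕℚ (d ℕ.* e)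
        ≡⟨ cong ((x ℚ.+ y) ℚ.*_) (fromℕℚ-* d e) ⟩
      (x ℚ.+ y) ℚ.* (D ℚ.* E)
        ≡⟨ solve 4 (λ x y d e → (x :+ y) :* (d :* e) := x :* d :* e :+ y :* e :* d)
             refl x y D E ⟩
      x ℚ.* D ℚ.* E ℚ.+ y ℚ.* E ℚ.* D
        ≡⟨ cong₂ (λ u v → u ℚ.* E ℚ.+ v ℚ.* D) eq eq′ ⟩
      pow k ℚ.* A ℚ.* E ℚ.+ pow k ℚ.* B ℚ.* D
        ≡⟨ solve 5 (λ q a b d e → q :* a :* e :+ q :* b :* d := q :* (a :* e :+ b :* d))
             refl (pow k) A B D E ⟩
      pow k ℚ.* (A ℚ.* E ℚ.+ B ℚ.* D)
        ≡⟨ cong (pow k ℚ.*_) (sym (trans (fromℤ-+ (a ℤ.* + e) (b ℤ.* + d))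
             (cong₂ ℚ._+_ (fromℤ-* a (+ e)) (fromℤ-* b (+ d))))) ⟩
      pow k ℚ.* fromℤ (a ℤ.* + e ℤ.+ b ℤ.* + d) ∎)
    where
    open ≡-Reasoning
    open +-*-Solver
    A = fromℤ a
    B = fromℤ b
    D = fromℕℚ d
    E = fromℕℚ e

  ≤ᵛ-neg : ∀ {k x} → k ≤ᵛ x → k ≤ᵛ ℚ.- x
  ≤ᵛ-neg {k} {x} (mk≤ᵛ a d p∤d eq) = mk≤ᵛ (ℤ.- a) d p∤d (begin
    ℚ.- x ℚ.* fromℕℚ d     ≡⟨ sym (ℚP.neg-distribˡ-* x (fromℕℚ d)) ⟩
    ℚ.- (x ℚ.* fromℕℚ d)   ≡⟨ cong ℚ.-_ eq ⟩
    ℚ.- (pow k ℚ.* fromℤ a) ≡⟨ ℚP.neg-distribʳ-* (pow k) (fromℤ a) ⟩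
    pow k ℚ.* ℚ.- fromℤ a   ≡⟨ cong (pow k ℚ.*_) (sym (fromℤ-neg a)) ⟩
    pow k ℚ.* fromℤ (ℤ.- a) ∎)
    where open ≡-Reasoning

  -- v_p(x) ≥ -m
  BoundedBy : ℕ → ℚ → Set
  BoundedBy m x = 0 ≤ᵛ pow m ℚ.* x

  ≤ᵛ-* : ∀ {m k x y} → BoundedBy m x → m ℕ.+ k ≤ᵛ y → k ≤ᵛ x ℚ.* y
  ≤ᵛ-* {m} {k} {x} {y} (mk≤ᵛ a d p∤d eq) (mk≤ᵛ b e p∤e eq′) =
    mk≤ᵛ (a ℤ.* b) (d ℕ.* e) (p∤* p∤d p∤e) (begin
      x ℚ.* y ℚ.* fromℕℚ (d ℕ.* e)
        ≡⟨ cong (x ℚ.* y ℚ.*_) (fromℕℚ-* d e) ⟩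
      x ℚ.* y ℚ.* (D ℚ.* E)
        ≡⟨ solve 4 (λ x y d e → x :* y :* (d :* e) := x :* d :* (y :* e)) refl x y D E ⟩
      x ℚ.* D ℚ.* (y ℚ.* E)
        ≡⟨ cong (x ℚ.* D ℚ.*_) (trans eq′ (cong (ℚ._* B) (pow-+ m k))) ⟩
      x ℚ.* D ℚ.* (pow m ℚ.* pow k ℚ.* B)
        ≡⟨ solve 5 (λ x d q r b → x :* d :* (q :* r :* b) := r :* (q :* x :* d :* b))
             refl x D (pow m) (pow k) B ⟩
      pow k ℚ.* (pow m ℚ.* x ℚ.* D ℚ.* B)
        ≡⟨ cong (λ u → pow k ℚ.* (u ℚ.* B)) (trans eq (ℚP.*-identityˡ A)) ⟩
      pow k ℚ.* (A ℚ.* B)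
        ≡⟨ cong (pow k ℚ.*_) (sym (fromℤ-* a b)) ⟩
      pow k ℚ.* fromℤ (a ℤ.* b) ∎)
    where
    open ≡-Reasoning
    open +-*-Solver
    A = fromℤ a
    B = fromℤ b
    D = fromℕℚ d
    E = fromℕℚ e

  split-power : ∀ n → Acc ℕ._<_ n → n ≢ 0 → ∃₂ λ m c → p ∤ c × p ℕ.^ m ℕ.* c ≡ n
  split-power n (acc rec) n≢0 with p ∣? n
  ... | no p∤n = 0 , n , p∤n , ℕP.*-identityˡ n
  ... | yes (divides q n≡qp) = extend (split-power q (rec q<n) q≢0)
    where
    q≢0 : q ≢ 0
    q≢0 q≡0 = n≢0 (trans n≡qp (cong (ℕ._* p) q≡0))
    q<n : q ℕ.< n
    q<n = subst (q ℕ.<_) (sym n≡qp)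
      (ℕP.m<m*n q p {{ℕ.≢-nonZero q≢0}} (ℕ.nonTrivial⇒n>1 p {{prime⇒nonTrivial isPrime}}))
    extend : (∃₂ λ m c → p ∤ c × p ℕ.^ m ℕ.* c ≡ q) → ∃₂ λ m c → p ∤ c × p ℕ.^ m ℕ.* c ≡ n
    extend (m , c , p∤c , eq) = suc m , c , p∤c , trans (ℕP.*-assoc p _ c)
      (trans (cong (p ℕ.*_) eq) (trans (ℕP.*-comm p q) (sym n≡qp)))

  bounded : ∀ x → ∃ λ m → BoundedBy m x
  bounded x with split-power (↧ₙ x) (<-wellFounded _) (λ ())
  ... | m , c , p∤c , eq = m , mk≤ᵛ (↥ x) c p∤c (begin
    pow m ℚ.* x ℚ.* fromℕℚ c
      ≡⟨ solve 3 (λ q x c → q :* x :* c := x :* (q :* c)) refl (pow m) x (fromℕℚ c) ⟩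
    x ℚ.* (pow m ℚ.* fromℕℚ c)
      ≡⟨ cong (x ℚ.*_) (trans (sym (fromℕℚ-* (p ℕ.^ m) c)) (cong fromℕℚ eq)) ⟩
    x ℚ.* fromℕℚ (↧ₙ x)
      ≡⟨ trans (clear-denominator x) (sym (ℚP.*-identityˡ _)) ⟩
    pow 0 ℚ.* fromℤ (↥ x) ∎)
    where
    open ≡-Reasoning
    open +-*-Solver

  BoundedBy-+ : ∀ {m x y} → BoundedBy m x → 0 ≤ᵛ y → BoundedBy m (x ℚ.+ y)
  BoundedBy-+ {m} {x} {y} bx by = subst (0 ≤ᵛ_) (sym (ℚP.*-distribˡ-+ (pow m) x y))
    (≤ᵛ-+ bx (≤ᵛ-* {0} {0} {pow m} {y} integral by))
    where
    integral : BoundedBy 0 (pow m)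
    integral = mk≤ᵛ (+ (p ℕ.^ m)) 1 p∤1 (ℚP.*-identityʳ _)

  eventually-bounded : ∀ x → ∃₂ λ m N → ∀ n → N ≤ n → BoundedBy m (seq x n)
  eventually-bounded x =
    let N , close = cauchy x 0
        m , b = bounded (seq x N)
    in m , N , λ n N≤n → subst (BoundedBy m)
         (solve 2 (λ u v → u :+ (v :- u) := v) refl (seq x N) (seq x n))
         (BoundedBy-+ {m} {seq x N} {seq x n ℚ.- seq x N} b (close n N N≤n ℕP.≤-refl))
    where open +-*-Solver

  ⊔-left : ∀ {a b n} → a ⊔ b ≤ n → a ≤ n
  ⊔-left = ℕP.m⊔n≤o⇒m≤o _ _

  ⊔-right : ∀ {a b n} → a ⊔ b ≤ n → b ≤ n
  ⊔-right {a} = ℕP.m⊔n≤o⇒n≤o a _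

  pointwise : ∀ {x y} → (∀ n → seq x n ≡ seq y n) → x ≈ y
  pointwise {x} {y} eq = mk≈ λ k → 0 , λ n _ → subst (k ≤ᵛ_)
    (sym (trans (cong (ℚ._- seq y n) (eq n)) (ℚP.+-inverseʳ (seq y n)))) (≤ᵛ-0 k)

  fromℚ : ℚ → ℚₚ
  fromℚ q = mkℚₚ (λ _ → q) λ k → 0 , λ _ _ _ _ → subst (k ≤ᵛ_) (sym (ℚP.+-inverseʳ q)) (≤ᵛ-0 k)

  infix  8 -_
  infixl 7 _*_
  infixl 6 _+_

  abstract
    +-cauchy : ∀ x y → Cauchy (λ n → seq x n ℚ.+ seq y n)
    +-cauchy x y = λ k →
      let M , cx = cauchy x k
          N , cy = cauchy y k
      in M ⊔ N , λ m n ≤m ≤n → subst (k ≤ᵛ_)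
           (solve 4 (λ a b c d → (a :- b) :+ (c :- d) := (a :+ c) :- (b :+ d)) refl
             (seq x m) (seq x n) (seq y m) (seq y n))
           (≤ᵛ-+ (cx m n (⊔-left ≤m) (⊔-left ≤n)) (cy m n (⊔-right {M} ≤m) (⊔-right {M} ≤n)))
      where open +-*-Solver

  _+_ : ℚₚ → ℚₚ → ℚₚ
  x + y = mkℚₚ (λ n → seq x n ℚ.+ seq y n) (+-cauchy x y)

  abstract
    neg-cauchy : ∀ x → Cauchy (λ n → ℚ.- seq x n)
    neg-cauchy x = λ k →
      let N , cx = cauchy x k
      in N , λ m n ≤m ≤n → subst (k ≤ᵛ_)
           (solve 2 (λ a b → :- (a :- b) := (:- a) :- (:- b)) refl (seq x m) (seq x n))
           (≤ᵛ-neg (cx m n ≤m ≤n))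
      where open +-*-Solver

  -_ : ℚₚ → ℚₚ
  - x = mkℚₚ (λ n → ℚ.- seq x n) (neg-cauchy x)

  abstract
    *-cauchy : ∀ x y → Cauchy (λ n → seq x n ℚ.* seq y n)
    *-cauchy x y = λ k →
      let i , I , bx = eventually-bounded x
          j , J , by = eventually-bounded y
          M , cx = cauchy x (j ℕ.+ k)
          N , cy = cauchy y (i ℕ.+ k)
      in (I ⊔ J) ⊔ (M ⊔ N) , λ m n ≤m ≤n → subst (k ≤ᵛ_)
           (solve 4 (λ a b c d → a :* (c :- d) :+ d :* (a :- b) := a :* c :- b :* d) refl
             (seq x m) (seq x n) (seq y m) (seq y n))
           (≤ᵛ-+
             (≤ᵛ-* {i} {k} {seq x m} {seq y m ℚ.- seq y n} (bx m (⊔-left {I} (⊔-left ≤m)))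
                   (cy m n (⊔-right {M} (⊔-right {I ⊔ J} ≤m)) (⊔-right {M} (⊔-right {I ⊔ J} ≤n))))
             (≤ᵛ-* {j} {k} {seq y n} {seq x m ℚ.- seq x n} (by n (⊔-right {I} (⊔-left ≤n)))
                   (cx m n (⊔-left {M} (⊔-right {I ⊔ J} ≤m)) (⊔-left {M} (⊔-right {I ⊔ J} ≤n)))))
      where open +-*-Solver

  _*_ : ℚₚ → ℚₚ → ℚₚ
  x * y = mkℚₚ (λ n → seq x n ℚ.* seq y n) (*-cauchy x y)

  ≈-refl : ∀ {x} → x ≈ x
  ≈-refl = pointwise λ _ → refl

  ≈-sym : ∀ {x y} → x ≈ y → y ≈ x
  ≈-sym {x} {y} (mk≈ e) = mk≈ λ k →
    let N , f = e k
    in N , λ n ≤n → subst (k ≤ᵛ_)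
         (solve 2 (λ a b → :- (a :- b) := b :- a) refl (seq x n) (seq y n)) (≤ᵛ-neg (f n ≤n))
    where open +-*-Solver

  ≈-trans : ∀ {x y z} → x ≈ y → y ≈ z → x ≈ z
  ≈-trans {x} {y} {z} (mk≈ e) (mk≈ e′) = mk≈ λ k →
    let M , f = e k
        N , g = e′ k
    in M ⊔ N , λ n ≤n → subst (k ≤ᵛ_)
         (solve 3 (λ a b c → (a :- b) :+ (b :- c) := a :- c) refl (seq x n) (seq y n) (seq z n))
         (≤ᵛ-+ (f n (⊔-left ≤n)) (g n (⊔-right {M} ≤n)))
    where open +-*-Solver

  +-cong : ∀ {x y u v} → x ≈ y → u ≈ v → x + u ≈ y + v
  +-cong {x} {y} {u} {v} (mk≈ e) (mk≈ e′) = mk≈ λ k →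
    let M , f = e k
        N , g = e′ k
    in M ⊔ N , λ n ≤n → subst (k ≤ᵛ_)
         (solve 4 (λ a b c d → (a :- b) :+ (c :- d) := (a :+ c) :- (b :+ d)) refl
           (seq x n) (seq y n) (seq u n) (seq v n))
         (≤ᵛ-+ (f n (⊔-left ≤n)) (g n (⊔-right {M} ≤n)))
    where open +-*-Solver

  -‿cong : ∀ {x y} → x ≈ y → - x ≈ - y
  -‿cong {x} {y} (mk≈ e) = mk≈ λ k →
    let N , f = e k
    in N , λ n ≤n → subst (k ≤ᵛ_)
         (solve 2 (λ a b → :- (a :- b) := (:- a) :- (:- b)) refl (seq x n) (seq y n))
         (≤ᵛ-neg (f n ≤n))
    where open +-*-Solver

  *-cong : ∀ {x y u v} → x ≈ y → u ≈ v → x * u ≈ y * v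
  *-cong {x} {y} {u} {v} (mk≈ e) (mk≈ e′) = mk≈ λ k →
    let i , I , bx = eventually-bounded x
        j , J , bv = eventually-bounded v
        M , f = e (j ℕ.+ k)
        N , g = e′ (i ℕ.+ k)
    in (I ⊔ J) ⊔ (M ⊔ N) , λ n ≤n → subst (k ≤ᵛ_)
         (solve 4 (λ a b c d → a :* (c :- d) :+ d :* (a :- b) := a :* c :- b :* d) refl
           (seq x n) (seq y n) (seq u n) (seq v n))
         (≤ᵛ-+
           (≤ᵛ-* {i} {k} {seq x n} {seq u n ℚ.- seq v n} (bx n (⊔-left {I} (⊔-left ≤n))) (g n (⊔-right {M} (⊔-right {I ⊔ J} ≤n))))
           (≤ᵛ-* {j} {k} {seq v n} {seq x n ℚ.- seq y n} (bv n (⊔-right {I} (⊔-left ≤n))) (f n (⊔-left {M} (⊔-right {I ⊔ J} ≤n)))))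
    where open +-*-Solver

  commutativeRing : CommutativeRing 0ℓ 0ℓ
  commutativeRing = record
    { Carrier = ℚₚ
    ; _≈_ = _≈_
    ; _+_ = _+_
    ; _*_ = _*_
    ; -_ = -_
    ; 0# = fromℚ 0ℚ
    ; 1# = fromℚ 1ℚ
    ; isCommutativeRing = record
      { isRing = record
        { +-isAbelianGroup = record
          { isGroup = record
            { isMonoid = record
              { isSemigroup = record
                { isMagma = record
                  { isEquivalence = record { refl = ≈-refl ; sym = ≈-sym ; trans = ≈-trans }
                  ; ∙-cong = +-cong
                  }
                ; assoc = λ x y z → pointwise λ n → ℚP.+-assoc (seq x n) (seq y n) (seq z n)
                }
              ; identity = (λ x → pointwise λ n → ℚP.+-identityˡ (seq x n))
                         , (λ x → pointwise λ n → ℚP.+-identityʳ (seq x n))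
              }
            ; inverse = (λ x → pointwise λ n → ℚP.+-inverseˡ (seq x n))
                      , (λ x → pointwise λ n → ℚP.+-inverseʳ (seq x n))
            ; ⁻¹-cong = -‿cong
            }
          ; comm = λ x y → pointwise λ n → ℚP.+-comm (seq x n) (seq y n)
          }
        ; *-cong = *-cong
        ; *-assoc = λ x y z → pointwise λ n → ℚP.*-assoc (seq x n) (seq y n) (seq z n)
        ; *-identity = (λ x → pointwise λ n → ℚP.*-identityˡ (seq x n))
                     , (λ x → pointwise λ n → ℚP.*-identityʳ (seq x n))
        ; distrib = (λ x y z → pointwise λ n → ℚP.*-distribˡ-+ (seq x n) (seq y n) (seq z n))
                  , (λ x y z → pointwise λ n → ℚP.*-distribʳ-+ (seq x n) (seq y n) (seq z n))
        }
      ; *-comm = λ x y → pointwise λ n → ℚP.*-comm (seq x n) (seq y n)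
      }
    }

------------------------------------------------------------------------

record Subring {c ℓ : Level} (R : CommutativeRing c ℓ) (m : Level) : Set (c ⊔ˡ ℓ ⊔ˡ lsuc m) where
  open CommutativeRing R
  field
    Member     : Pred Carrier m
    resp       : ∀ {x y} → x ≈ y → Member x → Member y
    0-closed   : Member 0#
    1-closed   : Member 1#
    +-closed   : ∀ {x y} → Member x → Member y → Member (x + y)
    *-closed   : ∀ {x y} → Member x → Member y → Member (x * y)
    neg-closed : ∀ {x} → Member x → Member (- x)

module _ {p : ℕ} (isPrime : Prime p) where

  open Padic isPrime using (ℚₚ; fromℚ; commutativeRing)
  open CommutativeRing commutativeRing using (semiring; _≈_; _*_; 0#)
  open Semiring semiring using (rawSemiring)
  open RawSemiringDefinitions rawSemiring using (_^_; sum)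

  -- The i-th entry of the vector is the coefficient of x^i.
  eval : ∀ {n} → Vec ℚ n → ℚₚ → ℚₚ
  eval a x = sum (λ i → fromℚ (lookup a i) * x ^ toℕ i)

  HasRootIn : ∀ {m n} → Subring commutativeRing m → Pred (Vec ℚ n) m
  HasRootIn D a = ∃ λ x → Subring.Member D x × eval a x ≈ 0#

------------------------------------------------------------------------

data Player : Set where
  nora wanda : Player

opponent : Player → Player
opponent nora  = wanda
opponent wanda = nora

-- Moves are numbered from 0.
mover : Player → ℕ → Player
mover first zero    = first
mover first (suc k) = opponent (mover first k)

lastMover : ℕ → Player → Player
lastMover d first = mover first d

module Game (d : ℕ) (first : Player) {ℓ : Level} (WandaWins : Pred (Vec ℚ (suc d)) ℓ) where

  Board : Set
  Board = Vec (Maybe ℚ) (suc d)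

  -- The side conditions are irrelevant so that two moves are equal as
  -- soon as they give the same value to the same coefficient.
  record Move (b : Board) : Set where
    constructor mkMove
    field
      index    : Fin (suc d)
      value    : ℚ
      .vacant  : lookup b index ≡ nothing
      .nonzero : index ≡ zero ⊎ index ≡ fromℕ d → value ≢ 0ℚ

  play : (b : Board) → Move b → Board
  play b m = b [ Move.index m ]≔ just (Move.value m)

  infixl 5 _▸_

  data History : ℕ → Board → Set where
    []  : History 0 (replicate (suc d) nothing)
    _▸_ : ∀ {k b} → History k b → (m : Move b) → History (suc k) (play b m)

  Strategy : Player → Set
  Strategy P = ∀ {k b} → k ≤ d → mover first k ≡ P → History k b → Move b

  Follows : ∀ {P k b} → Strategy P → History k b → Set
  Follows     σ []              = ⊤
  Follows {P} σ (_▸_ {k} h m) =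
    Follows σ h × ((k≤d : k ≤ d) (turn : mover first k ≡ P) → m ≡ σ k≤d turn h)

  WonBy : Player → Pred (Vec ℚ (suc d)) ℓ
  WonBy nora  a = ¬ WandaWins a
  WonBy wanda a = WandaWins a

  Winning : ∀ {P} → Strategy P → Set ℓ
  Winning {P} σ = ∀ {b} (h : History (suc d) b) → Follows σ h →
    ∃ λ a → b ≡ map just a × WonBy P a

  HasWinningStrategy : Player → Set ℓ
  HasWinningStrategy P = ∃ λ (σ : Strategy P) → Winning {P} σ

{-# OPTIONS --safe #-}

-- If Wanda moves last, the coefficients already chosen include a nonzero one, so
-- the polynomial g completed by 0 at the last index m is nonzero at r = p^K for
-- large K; then -g(r)/r^m is a legal last coefficient and makes r a root.
--
-- If Nora moves last, it suffices that v(f(q)) is bounded above for rational q;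
-- in her winning positions v(f(q)) ≤ v(f(0)).  When the last index m is 0, d or, for
-- d ≥ 5, at distance at least 2 from both, she plays p^(-M) with M large: whatever
-- the valuation of q, one of the terms of index 0, m, d strictly dominates,
-- provided that m ∤ M + v(a₀) and d - m ∤ M + v(a_d), which excludes ties.  For
-- d ≥ 5 she gets there by playing the indices 1 and d - 1 as early as possible.
-- For d ≤ 4, placing zeros at interior indices, she ends at 0, at d or with a
-- trinomial a_d x^d + t x^m + a₀.  If d ∤ v(a₀) - v(a_d) then t = 0 works;
-- otherwise, after rescaling, a₀ and a_d are units and a pigeonhole argument
-- gives a t for which there is no root modulo p.

module Submission where

open import Defs
open import Algebra.Bundles using (CommutativeRing; Semiring)
import Algebra.Definitions.RawSemiring as RawSemiringDefinitions
import Algebra.Properties.CommutativeMonoid.Sum as Sum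
import Algebra.Properties.CommutativeSemiring.Exp as Exp
open import Data.Empty using (⊥; ⊥-elim)
open import Data.Fin.Base as Fin using (Fin; zero; suc; punchIn; punchOut; toℕ; fromℕ; inject₁)
import Data.Fin.Properties as FinP
open import Data.Integer.Base as ℤ using (ℤ; +_; -[1+_]; _⊖_; 0ℤ; 1ℤ)
import Data.Integer.Divisibility.Signed as ℤD
import Data.Integer.DivMod as ℤDM
import Data.Integer.Properties as ℤP
import Data.Integer.Solver as ℤSolver
open import Data.List.Base using (List; []; _∷_; length)
import Data.List.Membership.DecPropositional as DecMembership
open import Data.List.Membership.Propositional using (_∈_; _∉_)
open import Data.List.Relation.Unary.Any using (here; there)
open import Data.Maybe.Base using (Maybe; just; nothing; fromMaybe)
import Data.Maybe.Properties as MaybeP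
open import Data.Nat.Base as ℕ using (ℕ; zero; suc; _≤_; _<_; z≤n; s≤s)
import Data.Nat.Coprimality as Coprimality
import Data.Nat.Divisibility as ℕD
open import Data.Nat.GCD using (module Bézout)
open import Data.Nat.Induction using (<-wellFounded)
open import Data.Nat.Primality using (Prime; prime⇒nonZero; prime⇒irreducible; euclidsLemma)
import Data.Nat.Properties as ℕP
import Data.Nat.Solver as ℕSolver
open import Data.Product.Base using (∃; ∃₂; _×_; _,_; proj₁; proj₂)
open import Data.Rational.Base as ℚ using (ℚ; 0ℚ; 1ℚ; ↥_; ↧ₙ_; _+_; _*_; -_; _-_)
open import Data.Rational.Literals using (fromℤ)
import Data.Rational.Properties as ℚP
open import Data.Rational.Solver using (module +-*-Solver)
open import Data.Sign.Base as Sign using (Sign)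
open import Data.Sum.Base using (_⊎_; inj₁; inj₂; [_,_]′)
open import Data.Vec.Base using (Vec; []; _∷_; lookup; map; replicate; _[_]≔_)
open import Data.Vec.Functional using (removeAt)
import Data.Vec.Properties as VecP
open import Level using (Level)
open import Relation.Binary.Definitions using (tri<; tri≈; tri>)
open import Relation.Binary.PropositionalEquality
  using (_≡_; _≢_; refl; sym; trans; cong; cong₂; subst; module ≡-Reasoning)
open import Relation.Nullary.Decidable using (Dec; yes; no; ¬?; recompute; _×-dec_; _⊎-dec_; _→-dec_)
open import Relation.Nullary.Negation using (¬_; contradiction)
open import Relation.Unary using (Pred)

open Exp (CommutativeRing.commutativeSemiring ℚP.+-*-commutativeRing) using (_^_; ^-distrib-*)
open Sum ℚP.+-0-commutativeMonoid using (sum; sum-remove; sum-cong-≗; sum-replicate-zero)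

-- Elements of ℚₚ are Cauchy sequences of rationals and polynomials act on them termwise, so a root
-- would make v(f(q)) unbounded along rational q; this is why rational arguments decide the matter.
-- Nora excludes roots in all of ℚₚ, while Wanda's root is a natural number, a sum of ones, so the
-- winner is the same for every subring. The obstacle is a tie between the large term and an end
-- term. Divisibility by 1 cannot be avoided, so next to an end a large coefficient ties for every
-- M; hence the indices 1 and d - 1 must be gone before the last move. Two distances equal to 2 are
-- bad as well, since two parity conditions may forbid every M. That happens only for d = 4 and m =
-- 2, whence the threshold 5. For d ≤ 4 at most two of the d moves before the last are Wanda's. If
-- an interior index is still open then, Nora has placed only interior zeros, so both ends were
-- filled by Wanda and no move of hers went inside.

fromℤ-injective : ∀ {a b} → fromℤ a ≡ fromℤ b → a ≡ b
fromℤ-injective = cong ↥_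

i≤+∣i∣ : ∀ i → i ℤ.≤ + ℤ.∣ i ∣
i≤+∣i∣ (+ n)    = ℤP.≤-refl
i≤+∣i∣ -[1+ n ] = ℤ.-≤+

i<suc[i] : ∀ i → i ℤ.< ℤ.suc i
i<suc[i] i = ℤP.suc[i]≤j⇒i<j ℤP.≤-refl

fromℕℚ-+ : ∀ a b → fromℕℚ (a ℕ.+ b) ≡ fromℕℚ a + fromℕℚ b
fromℕℚ-+ a b = trans (cong fromℤ (ℤP.pos-+ a b)) (fromℤ-+ (+ a) (+ b))

-- Valuations of rational numbers

module Valuation {p : ℕ} (isPrime : Prime p) where

  open Padic isPrime using (pow; pow-+; _≤ᵛ_; mk≤ᵛ; p∤1; p∤*; split-power; ≤ᵛ-0; ≤ᵛ-+; ≤ᵛ-*)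

  abstract
    -- Opaque: `pow-inverseʳ` is the only fact about it used outside, so the reciprocal never
    -- unfolds.
    1/pow : ℕ → ℚ
    1/pow n = ℚ.1/_ (pow n) {{ℚ.≢-nonZero λ e →
      ℕ.≢-nonZero⁻¹ (p ℕ.^ n) {{ℕP.m^n≢0 p n {{prime⇒nonZero isPrime}}}} (ℤP.+-injective (fromℤ-injective e))}}

    pow-inverseʳ : ∀ n → pow n * 1/pow n ≡ 1ℚ
    pow-inverseʳ n = ℚP.*-inverseʳ (pow n) {{_}}

  π : ℤ → ℚ
  π (+ n)    = pow n
  π -[1+ n ] = 1/pow (suc n)

  π-≡ : ∀ {x n} → x * pow n ≡ 1ℚ → x ≡ 1/pow n
  π-≡ {x} {n} e = begin
    x                      ≡⟨ sym (ℚP.*-identityʳ x) ⟩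
    x * 1ℚ                 ≡⟨ cong (x *_) (sym (pow-inverseʳ n)) ⟩
    x * (pow n * 1/pow n)  ≡⟨ sym (ℚP.*-assoc x _ _) ⟩
    x * pow n * 1/pow n    ≡⟨ cong (_* 1/pow n) e ⟩
    1ℚ * 1/pow n           ≡⟨ ℚP.*-identityˡ _ ⟩
    1/pow n                ∎
    where open ≡-Reasoning

  -- Integers of opposite sign are added by `⊖`, so this settles both mixed cases of `π-+`.
  π-⊖ : ∀ a b → π (a ⊖ b) ≡ pow a * 1/pow b
  π-⊖ a b with ℕP.≤-total b a
  ... | inj₁ b≤a = begin
    π (a ⊖ b)                          ≡⟨ cong π (ℤP.⊖-≥ b≤a) ⟩
    pow (a ℕ.∸ b)                      ≡⟨ sym (ℚP.*-identityʳ _) ⟩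
    pow (a ℕ.∸ b) * 1ℚ                 ≡⟨ cong (pow (a ℕ.∸ b) *_) (sym (pow-inverseʳ b)) ⟩
    pow (a ℕ.∸ b) * (pow b * 1/pow b)  ≡⟨ sym (ℚP.*-assoc (pow (a ℕ.∸ b)) (pow b) (1/pow b)) ⟩
    pow (a ℕ.∸ b) * pow b * 1/pow b    ≡⟨ cong (_* 1/pow b) (sym (pow-+ (a ℕ.∸ b) b)) ⟩
    pow (a ℕ.∸ b ℕ.+ b) * 1/pow b      ≡⟨ cong (λ k → pow k * 1/pow b) (ℕP.m∸n+n≡m b≤a) ⟩
    pow a * 1/pow b                    ∎
    where open ≡-Reasoning
  ... | inj₂ a≤b = trans (cong π (ℤP.⊖-≤ a≤b)) (trans (π-neg (b ℕ.∸ a)) (sym (π-≡ (begin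
    pow a * 1/pow b * pow (b ℕ.∸ a)    ≡⟨ solve 3 (λ x y z → x :* y :* z := z :* x :* y) refl (pow a) (1/pow b)
        (pow (b ℕ.∸ a)) ⟩
    pow (b ℕ.∸ a) * pow a * 1/pow b    ≡⟨ cong (_* 1/pow b) (sym (pow-+ (b ℕ.∸ a) a)) ⟩
    pow (b ℕ.∸ a ℕ.+ a) * 1/pow b      ≡⟨ cong (λ k → pow k * 1/pow b) (ℕP.m∸n+n≡m a≤b) ⟩
    pow b * 1/pow b                    ≡⟨ pow-inverseʳ b ⟩
    1ℚ                                 ∎))))
    where
    open ≡-Reasoning
    open +-*-Solver
    π-neg : ∀ n → π (ℤ.- + n) ≡ 1/pow n
    π-neg zero    = π-≡ {1ℚ} {0} refl
    π-neg (suc n) = refl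

  π-+ : ∀ i j → π (i ℤ.+ j) ≡ π i * π j
  π-+ (+ a)    (+ b)    = pow-+ a b
  π-+ (+ a)    -[1+ b ] = π-⊖ a (suc b)
  π-+ -[1+ a ] (+ b)    = trans (π-⊖ b (suc a)) (ℚP.*-comm (pow b) (1/pow (suc a)))
  π-+ -[1+ a ] -[1+ b ] = sym (π-≡ (begin
    x * y * pow (suc (suc (a ℕ.+ b)))          ≡⟨ cong (λ k → x * y * pow k) (cong suc (sym (ℕP.+-suc a b))) ⟩
    x * y * pow (suc a ℕ.+ suc b)              ≡⟨ cong (x * y *_) (pow-+ (suc a) (suc b)) ⟩
    x * y * (pow (suc a) * pow (suc b))        ≡⟨ solve 4 (λ x y z w → x :* y :* (z :* w) := z :* x :* (w :* y))
        refl x y (pow (suc a)) (pow (suc b)) ⟩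
    pow (suc a) * x * (pow (suc b) * y)        ≡⟨ cong₂ _*_ (pow-inverseʳ (suc a)) (pow-inverseʳ (suc b)) ⟩
    1ℚ                                         ∎))
    where
    open ≡-Reasoning
    open +-*-Solver
    x = 1/pow (suc a)
    y = 1/pow (suc b)

  π-cancel : ∀ s x → π s * (π (ℤ.- s) * x) ≡ x
  π-cancel s x = begin
    π s * (π (ℤ.- s) * x)  ≡⟨ sym (ℚP.*-assoc (π s) _ x) ⟩
    π s * π (ℤ.- s) * x    ≡⟨ cong (_* x) (sym (π-+ s (ℤ.- s))) ⟩
    π (s ℤ.- s) * x        ≡⟨ cong (λ i → π i * x) (ℤP.+-inverseʳ s) ⟩
    1ℚ * x                 ≡⟨ ℚP.*-identityˡ x ⟩
    x                      ∎
    where open ≡-Reasoning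

  Integral : ℚ → Set
  Integral x = 0 ≤ᵛ x

  fromℤ-integral : ∀ n → Integral (fromℤ n)
  fromℤ-integral n = mk≤ᵛ n 1 p∤1 (trans (ℚP.*-identityʳ (fromℤ n)) (sym (ℚP.*-identityˡ (fromℤ n))))

  Integral-* : ∀ {x y} → Integral x → Integral y → Integral (x * y)
  Integral-* {x} {y} ix = ≤ᵛ-* {0} {0} {x} {y} (subst Integral (sym (ℚP.*-identityˡ x)) ix)

  infix 4 _≼_

  -- v_p(x) ≥ s, now for every integer s
  record _≼_ (s : ℤ) (x : ℚ) : Set where
    constructor mk≼
    field
      cofactor : ℚ
      integral : Integral cofactor
      equation : x ≡ π s * cofactor

  -- A unit of the local ring at p. The fraction need not be in lowest terms, so products and sums
  -- are formed by cross-multiplication.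
  record Unit (u : ℚ) : Set where
    constructor mkUnit
    field
      num      : ℤ
      den      : ℕ
      p∤num    : ¬ (+ p ℤD.∣ num)
      p∤den    : p ℕD.∤ den
      equation : u * fromℕℚ den ≡ fromℤ num

  -- v_p(x) = s
  record Exact (s : ℤ) (x : ℚ) : Set where
    constructor mkExact
    field
      cofactor : ℚ
      unit     : Unit cofactor
      equation : x ≡ π s * cofactor

  Unit⇒Integral : ∀ {u} → Unit u → Integral u
  Unit⇒Integral (mkUnit n e _ p∤e eq) = mk≤ᵛ n e p∤e (trans eq (sym (ℚP.*-identityˡ (fromℤ n))))

  Exact⇒≼ : ∀ {s x} → Exact s x → s ≼ x
  Exact⇒≼ (mkExact u unit eq) = mk≼ u (Unit⇒Integral unit) eq

  ≼-0 : ∀ {s} → s ≼ 0ℚ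
  ≼-0 {s} = mk≼ 0ℚ (≤ᵛ-0 0) (sym (ℚP.*-zeroʳ (π s)))

  ≼-+ : ∀ {s x y} → s ≼ x → s ≼ y → s ≼ x + y
  ≼-+ {s} (mk≼ a ia refl) (mk≼ b ib refl) = mk≼ (a + b) (≤ᵛ-+ ia ib) (sym (ℚP.*-distribˡ-+ (π s) a b))

  ≼-* : ∀ {s t x y} → s ≼ x → t ≼ y → s ℤ.+ t ≼ x * y
  ≼-* {s} {t} (mk≼ a ia refl) (mk≼ b ib refl) = mk≼ (a * b) (Integral-* ia ib)
    (trans (solve 4 (λ x y z w → x :* y :* (z :* w) := x :* z :* (y :* w)) refl (π s) a (π t) b)
      (cong (_* (a * b)) (sym (π-+ s t))))
    where open +-*-Solver

  ≼-weaken : ∀ {s t x} → s ℤ.≤ t → t ≼ x → s ≼ x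
  ≼-weaken {s} {t} {x} s≤t (mk≼ a ia refl) = mk≼ (π (t ℤ.- s) * a)
    (Integral-* (subst (λ i → Integral (π i)) (ℤP.0≤i⇒+∣i∣≡i (ℤP.i≤j⇒0≤j-i s≤t))
        (fromℤ-integral (+ (p ℕ.^ ℤ.∣ t ℤ.- s ∣)))) ia)
    (begin
      π t * a                    ≡⟨ cong (λ i → π i * a) (solve 2 (λ s t → t := s :+ (t :- s)) refl s t) ⟩
      π (s ℤ.+ (t ℤ.- s)) * a    ≡⟨ cong (_* a) (π-+ s (t ℤ.- s)) ⟩
      π s * π (t ℤ.- s) * a      ≡⟨ ℚP.*-assoc (π s) _ a ⟩
      π s * (π (t ℤ.- s) * a)    ∎)
    where
    open ≡-Reasoning
    open ℤSolver.+-*-Solver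

  ≤ᵛ⇒≼ : ∀ {k x} → k ≤ᵛ x → + k ≼ x
  ≤ᵛ⇒≼ {k} {x} (mk≤ᵛ n e p∤e eq) = mk≼ (π (ℤ.- + k) * x)
    (mk≤ᵛ n e p∤e (begin
      π (ℤ.- + k) * x * fromℕℚ e        ≡⟨ ℚP.*-assoc (π (ℤ.- + k)) x _ ⟩
      π (ℤ.- + k) * (x * fromℕℚ e)      ≡⟨ cong (π (ℤ.- + k) *_) eq ⟩
      π (ℤ.- + k) * (pow k * fromℤ n)   ≡⟨ solve 3 (λ a b c → a :* (b :* c) := b :* (a :* c)) refl (π (ℤ.- + k))
          (pow k) (fromℤ n) ⟩
      π (+ k) * (π (ℤ.- + k) * fromℤ n) ≡⟨ π-cancel (+ k) (fromℤ n) ⟩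
      fromℤ n                           ≡⟨ sym (ℚP.*-identityˡ (fromℤ n)) ⟩
      1ℚ * fromℤ n                      ∎))
    (sym (π-cancel (+ k) x))
    where
    open ≡-Reasoning
    open +-*-Solver

  p∤⇒∤ : ∀ {n} → p ℕD.∤ ℤ.∣ n ∣ → ¬ (+ p ℤD.∣ n)
  p∤⇒∤ p∤n p∣n = p∤n (ℤD.∣⇒∣ᵤ p∣n)

  ∤-* : ∀ {a b} → ¬ (+ p ℤD.∣ a) → ¬ (+ p ℤD.∣ b) → ¬ (+ p ℤD.∣ a ℤ.* b)
  ∤-* {a} {b} p∤a p∤b p∣ab = p∤* (λ d → p∤a (ℤD.∣ᵤ⇒∣ d)) (λ d → p∤b (ℤD.∣ᵤ⇒∣ d))
    (subst (p ℕD.∣_) (ℤP.abs-* a b) (ℤD.∣⇒∣ᵤ p∣ab))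

  Unit-1 : Unit 1ℚ
  Unit-1 = mkUnit (+ 1) 1 (p∤⇒∤ p∤1) p∤1 refl

  Unit-* : ∀ {u v} → Unit u → Unit v → Unit (u * v)
  Unit-* {u} {v} (mkUnit a d p∤a p∤d eq) (mkUnit b e p∤b p∤e eq′) =
    mkUnit (a ℤ.* b) (d ℕ.* e) (∤-* p∤a p∤b) (p∤* p∤d p∤e) (begin
      u * v * fromℕℚ (d ℕ.* e)          ≡⟨ cong (u * v *_) (fromℕℚ-* d e) ⟩
      u * v * (fromℕℚ d * fromℕℚ e)     ≡⟨ solve 4 (λ x y z w → x :* y :* (z :* w) := x :* z :* (y :* w)) refl u
          v (fromℕℚ d) (fromℕℚ e) ⟩
      u * fromℕℚ d * (v * fromℕℚ e)     ≡⟨ cong₂ _*_ eq eq′ ⟩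
      fromℤ a * fromℤ b                 ≡⟨ sym (fromℤ-* a b) ⟩
      fromℤ (a ℤ.* b)                   ∎)
    where
    open ≡-Reasoning
    open +-*-Solver

  -- Modulo p the numerator of the sum is `a * e`, a product of two integers prime to p.
  Unit-+ : ∀ {u y} → Unit u → Integral y → Unit (u + pow 1 * y)
  Unit-+ {u} {y} (mkUnit a d p∤a p∤d eq) (mk≤ᵛ b e p∤e eq′) =
    mkUnit (a ℤ.* + e ℤ.+ + (p ℕ.^ 1) ℤ.* b ℤ.* + d) (d ℕ.* e)
      (λ p∣ → ∤-* p∤a (p∤⇒∤ p∤e) (ℤD.∣m+n∣n⇒∣m p∣ (ℤD.∣m⇒∣m*n (+ d) (ℤD.∣m⇒∣m*n b
        (subst (λ q → + p ℤD.∣ + q) (sym (ℕP.*-identityʳ p)) ℤD.∣-refl)))))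
      (p∤* p∤d p∤e) (begin
      (u + pow 1 * y) * fromℕℚ (d ℕ.* e)
        ≡⟨ cong ((u + pow 1 * y) *_) (fromℕℚ-* d e) ⟩
      (u + pow 1 * y) * (D * E)
        ≡⟨ solve 5 (λ u q y d e → (u :+ q :* y) :* (d :* e) := u :* d :* e :+ q :* (y :* e) :* d) refl u (pow 1)
            y D E ⟩
      u * D * E + pow 1 * (y * E) * D
        ≡⟨ cong₂ (λ v w → v * E + pow 1 * w * D) eq (trans eq′ (ℚP.*-identityˡ (fromℤ b))) ⟩
      fromℤ a * E + pow 1 * fromℤ b * D
        ≡⟨ cong₂ _+_ (sym (fromℤ-* a (+ e))) (trans (cong (_* D) (sym (fromℤ-* (+ (p ℕ.^ 1)) b)))
            (sym (fromℤ-* (+ (p ℕ.^ 1) ℤ.* b) (+ d)))) ⟩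
      fromℤ (a ℤ.* + e) + fromℤ (+ (p ℕ.^ 1) ℤ.* b ℤ.* + d)
        ≡⟨ sym (fromℤ-+ (a ℤ.* + e) (+ (p ℕ.^ 1) ℤ.* b ℤ.* + d)) ⟩
      fromℤ (a ℤ.* + e ℤ.+ + (p ℕ.^ 1) ℤ.* b ℤ.* + d) ∎)
    where
    open ≡-Reasoning
    open +-*-Solver
    D = fromℕℚ d
    E = fromℕℚ e

  -- Clearing denominators makes p divide `a * e`, although both factors are prime to p.
  ¬Unit-pow1* : ∀ {u y} → Integral y → u ≡ pow 1 * y → ¬ Unit u
  ¬Unit-pow1* {u} {y} (mk≤ᵛ b e p∤e eq′) refl (mkUnit a d p∤a p∤d eq) =
    ∤-* p∤a (p∤⇒∤ p∤e) (subst (+ p ℤD.∣_) (sym ae≡) (ℤD.∣m⇒∣m*n (+ d) (ℤD.∣m⇒∣m*n b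
        (subst (λ q → + p ℤD.∣ + q) (sym (ℕP.*-identityʳ p)) ℤD.∣-refl))))
    where
    open ≡-Reasoning
    open +-*-Solver
    D = fromℕℚ d
    E = fromℕℚ e
    ae≡ : a ℤ.* + e ≡ + (p ℕ.^ 1) ℤ.* b ℤ.* + d
    ae≡ = fromℤ-injective (begin
      fromℤ (a ℤ.* + e)         ≡⟨ fromℤ-* a (+ e) ⟩
      fromℤ a * E               ≡⟨ cong (_* E) (sym eq) ⟩
      pow 1 * y * D * E         ≡⟨ solve 4 (λ q y d e → q :* y :* d :* e := q :* (y :* e) :* d) refl (pow 1) y D E ⟩
      pow 1 * (y * E) * D       ≡⟨ cong (λ w → pow 1 * w * D) (trans eq′ (ℚP.*-identityˡ (fromℤ b))) ⟩
      pow 1 * fromℤ b * D       ≡⟨ trans (cong (_* D) (sym (fromℤ-* (+ (p ℕ.^ 1)) b)))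
          (sym (fromℤ-* (+ (p ℕ.^ 1) ℤ.* b) (+ d))) ⟩
      fromℤ (+ (p ℕ.^ 1) ℤ.* b ℤ.* + d) ∎)

  π-injective : ∀ s {x y} → π s * x ≡ π s * y → x ≡ y
  π-injective s {x} {y} e = begin
    x                       ≡⟨ sym (unscale x) ⟩
    π (ℤ.- s) * (π s * x)   ≡⟨ cong (π (ℤ.- s) *_) e ⟩
    π (ℤ.- s) * (π s * y)   ≡⟨ unscale y ⟩
    y                       ∎
    where
    open ≡-Reasoning
    unscale : ∀ z → π (ℤ.- s) * (π s * z) ≡ z
    unscale z = trans (cong (λ i → π (ℤ.- s) * (π i * z)) (sym (ℤP.neg-involutive s))) (π-cancel (ℤ.- s) z)

  -- It is enough to refute the bound s + 1: after division by p^s, the unit cofactor would be a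
  -- multiple of p.
  Exact⇒⋠ : ∀ {s t x} → Exact s x → s ℤ.< t → ¬ (t ≼ x)
  Exact⇒⋠ {s} {t} (mkExact u unit refl) s<t t≼x with ≼-weaken (ℤP.i<j⇒suc[i]≤j s<t) t≼x
  ... | mk≼ a ia eq = ¬Unit-pow1* ia (π-injective s (begin
    π s * u              ≡⟨ eq ⟩
    π (ℤ.suc s) * a      ≡⟨ cong (λ i → π i * a) (ℤP.+-comm 1ℤ s) ⟩
    π (s ℤ.+ 1ℤ) * a     ≡⟨ cong (_* a) (π-+ s 1ℤ) ⟩
    π s * pow 1 * a      ≡⟨ ℚP.*-assoc (π s) _ a ⟩
    π s * (pow 1 * a)    ∎)) unit
    where open ≡-Reasoning

  -- The strict case of the ultrametric inequality: a summand of larger valuation changes the unit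
  -- cofactor by a multiple of p only.
  Exact-+ : ∀ {s x y} → Exact s x → ℤ.suc s ≼ y → Exact s (x + y)
  Exact-+ {s} (mkExact u unit refl) (mk≼ a ia refl) = mkExact (u + pow 1 * a) (Unit-+ unit ia) (begin
    π s * u + π (ℤ.suc s) * a     ≡⟨ cong (λ i → π s * u + π i * a) (ℤP.+-comm 1ℤ s) ⟩
    π s * u + π (s ℤ.+ 1ℤ) * a    ≡⟨ cong (λ w → π s * u + w * a) (π-+ s 1ℤ) ⟩
    π s * u + π s * pow 1 * a     ≡⟨ solve 4 (λ q u r a → q :* u :+ q :* r :* a := q :* (u :+ r :* a)) refl
        (π s) u (pow 1) a ⟩
    π s * (u + pow 1 * a)         ∎)
    where
    open ≡-Reasoning
    open +-*-Solver

  Exact-* : ∀ {s t x y} → Exact s x → Exact t y → Exact (s ℤ.+ t) (x * y)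
  Exact-* {s} {t} (mkExact a ia refl) (mkExact b ib refl) = mkExact (a * b) (Unit-* ia ib)
    (trans (solve 4 (λ x y z w → x :* y :* (z :* w) := x :* z :* (y :* w)) refl (π s) a (π t) b)
      (cong (_* (a * b)) (sym (π-+ s t))))
    where open +-*-Solver

  Exact-^ : ∀ {s x} n → Exact s x → Exact (+ n ℤ.* s) (x ^ n)
  Exact-^ {s} zero    ex = mkExact 1ℚ Unit-1 refl
  Exact-^ {s} (suc n) ex = subst (λ i → Exact i _) (sym (ℤP.suc-* (+ n) s)) (Exact-* ex (Exact-^ n ex))

  Exact-π : ∀ s → Exact s (π s)
  Exact-π s = mkExact 1ℚ Unit-1 (sym (ℚP.*-identityʳ (π s)))

  -- Splitting p^a off the numerator and p^b off the denominator gives the valuation a - b; what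
  -- remains is `c`, with the sign of x, over `e`.
  exact : ∀ {x} → x ≢ 0ℚ → ∃ λ s → Exact s x
  exact {x} x≢0
    with split-power ℤ.∣ ↥ x ∣ (<-wellFounded _) (λ e → x≢0 (ℚP.↥p≡0⇒p≡0 x (ℤP.∣i∣≡0⇒i≡0 e)))
       | split-power (↧ₙ x) (<-wellFounded _) (λ ())
  ... | a , c , p∤c , eq | b , e , p∤e , eq′ = s , mkExact (π (ℤ.- s) * x)
    (mkUnit (ℤ.sign (↥ x) ℤ.◃ c) e (p∤⇒∤ (subst (p ℕD.∤_) (sym (ℤP.abs-◃ (ℤ.sign (↥ x)) c)) p∤c)) p∤e
      (π-injective s (begin
        π s * (π (ℤ.- s) * x * E)       ≡⟨ solve 4 (λ a b c d → a :* (b :* c :* d) := a :* (b :* c) :* d) refl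
            (π s) (π (ℤ.- s)) x E ⟩
        π s * (π (ℤ.- s) * x) * E       ≡⟨ cong (_* E) (π-cancel s x) ⟩
        x * E                           ≡⟨ sym (ℚP.*-identityʳ (x * E)) ⟩
        x * E * 1ℚ                      ≡⟨ cong (x * E *_) (sym (pow-inverseʳ b)) ⟩
        x * E * (pow b * 1/pow b)       ≡⟨ solve 4 (λ a b c d → a :* b :* (c :* d) := a :* (c :* b) :* d) refl x
            E (pow b) (1/pow b) ⟩
        x * (pow b * E) * 1/pow b       ≡⟨ cong (_* 1/pow b) numerator ⟩
        pow a * fromℤ n * 1/pow b       ≡⟨ solve 3 (λ a b c → a :* b :* c := a :* c :* b) refl (pow a) (fromℤ n)
            (1/pow b) ⟩
        pow a * 1/pow b * fromℤ n       ≡⟨ cong (_* fromℤ n) (sym (π-⊖ a b)) ⟩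
        π s * fromℤ n                   ∎)))
    (sym (π-cancel s x))
    where
    open ≡-Reasoning
    open +-*-Solver
    s = a ⊖ b
    n = ℤ.sign (↥ x) ℤ.◃ c
    E = fromℕℚ e
    numerator : x * (pow b * E) ≡ pow a * fromℤ n
    numerator = begin
      x * (pow b * E)            ≡⟨ cong (x *_) (trans (sym (fromℕℚ-* (p ℕ.^ b) e)) (cong fromℕℚ eq′)) ⟩
      x * fromℕℚ (↧ₙ x)          ≡⟨ clear-denominator x ⟩
      fromℤ (↥ x)                ≡⟨ cong fromℤ (sym (ℤP.signᵢ◃∣i∣≡i (↥ x))) ⟩
      fromℤ (ℤ.sign (↥ x) ℤ.◃ ℤ.∣ ↥ x ∣)              ≡⟨ cong (λ k → fromℤ (ℤ.sign (↥ x) ℤ.◃ k)) (sym eq) ⟩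
      fromℤ (ℤ.sign (↥ x) ℤ.◃ (p ℕ.^ a ℕ.* c))        ≡⟨ cong fromℤ (sym (◃-*ˡ (ℤ.sign (↥ x)))) ⟩
      fromℤ (+ (p ℕ.^ a) ℤ.* n)  ≡⟨ fromℤ-* (+ (p ℕ.^ a)) n ⟩
      pow a * fromℤ n            ∎
      where
      ◃-*ˡ : ∀ t → + (p ℕ.^ a) ℤ.* (t ℤ.◃ c) ≡ t ℤ.◃ (p ℕ.^ a ℕ.* c)
      ◃-*ˡ Sign.+ = trans (cong (+ (p ℕ.^ a) ℤ.*_) (ℤP.+◃n≡+n c))
        (trans (sym (ℤP.pos-* (p ℕ.^ a) c)) (sym (ℤP.+◃n≡+n _)))
      ◃-*ˡ Sign.- = trans (cong (+ (p ℕ.^ a) ℤ.*_) (ℤP.-◃n≡-n c))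
        (trans (sym (ℤP.neg-distribʳ-* (+ (p ℕ.^ a)) (+ c)))
          (trans (cong ℤ.-_ (sym (ℤP.pos-* (p ℕ.^ a) c))) (sym (ℤP.-◃n≡-n _))))

  lower-bound : ∀ x → ∃ λ s → s ≼ x
  lower-bound x with x ℚP.≟ 0ℚ
  ... | yes refl = 0ℤ , ≼-0
  ... | no x≢0 = let s , ex = exact x≢0 in s , Exact⇒≼ ex

  ≼-sum : ∀ {s n} (t : Fin n → ℚ) → (∀ i → s ≼ t i) → s ≼ sum t
  ≼-sum {n = zero}  t b = ≼-0
  ≼-sum {n = suc n} t b = ≼-+ (b zero) (≼-sum (λ i → t (suc i)) (λ i → b (suc i)))

  Exact-sum : ∀ {s n} (t : Fin n → ℚ) j → Exact s (t j) → (∀ i → i ≢ j → ℤ.suc s ≼ t i) → Exact s (sum t)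
  Exact-sum {s} {suc n} t j ex b = subst (Exact s) (sym (sum-remove t))
    (Exact-+ ex (≼-sum (removeAt t j) (λ i → b (punchIn j i) (FinP.punchInᵢ≢i j i))))

  -- The sum is no smaller than its distinguished term, because the unique
  -- dominant term is at least as large as that one.
  dominated : ∀ {s n v} (t : Fin n → ℚ) i → Exact v (t i) →
    ∀ j → Exact s (t j) → (∀ k → k ≢ j → ℤ.suc s ≼ t k) → ¬ (ℤ.suc v ≼ sum t)
  dominated {s} {n} {v} t i exi j exj b v<∑ with i FinP.≟ j
  ... | yes refl = Exact⇒⋠ (Exact-sum t j exj b) (ℤP.≤-<-trans (s≤v) (i<suc[i] v)) v<∑
    where
    s≤v : s ℤ.≤ v
    s≤v = ℤP.≮⇒≥ λ v<s → Exact⇒⋠ exi v<s (Exact⇒≼ exj)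
  ... | no i≢j = Exact⇒⋠ (Exact-sum t j exj b) (ℤP.<-trans s<v (i<suc[i] v)) v<∑
    where
    s<v : s ℤ.< v
    s<v = ℤP.≰⇒> λ v≤s → Exact⇒⋠ exi (ℤP.suc[i]≤j⇒i<j (ℤP.suc-mono v≤s)) (b i i≢j)

-- Residues modulo p

module Residues {p : ℕ} (isPrime : Prime p) where

  open Padic isPrime using (pow; mk≤ᵛ; p∤1)
  open Valuation isPrime

  -- Bézout's identity for p and e. Its two cases differ in which side carries the 1, hence the
  -- opposite signs of the inverse.
  inverse-mod : ∀ {e} → p ℕD.∤ e → ∃₂ λ f k → + e ℤ.* f ℤ.- 1ℤ ≡ k ℤ.* + p
  inverse-mod {e} p∤e with Coprimality.coprime-Bézout coprime
    where
    coprime : Coprimality.Coprime p e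
    coprime (d∣p , d∣e) with prime⇒irreducible isPrime d∣p
    ... | inj₁ d≡1  = d≡1
    ... | inj₂ refl = contradiction d∣e p∤e
  ... | Bézout.+- x y eq = ℤ.- + y , ℤ.- + x , (begin
    + e ℤ.* (ℤ.- + y) ℤ.- 1ℤ     ≡⟨ solve 2 (λ e y → e :* (:- y) :- con 1ℤ := :- (con 1ℤ :+ y :* e)) refl (+ e)
        (+ y) ⟩
    ℤ.- (1ℤ ℤ.+ + y ℤ.* + e)     ≡⟨ cong (λ i → ℤ.- (1ℤ ℤ.+ i)) (sym (ℤP.pos-* y e)) ⟩
    ℤ.- (+ (1 ℕ.+ y ℕ.* e))      ≡⟨ cong (λ i → ℤ.- + i) eq ⟩
    ℤ.- (+ (x ℕ.* p))            ≡⟨ cong ℤ.-_ (ℤP.pos-* x p) ⟩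
    ℤ.- (+ x ℤ.* + p)            ≡⟨ ℤP.neg-distribˡ-* (+ x) (+ p) ⟩
    (ℤ.- + x) ℤ.* + p            ∎)
    where
    open ≡-Reasoning
    open ℤSolver.+-*-Solver
  ... | Bézout.-+ x y eq = + y , + x , (begin
    + e ℤ.* + y ℤ.- 1ℤ           ≡⟨ cong (ℤ._- 1ℤ) (trans (ℤP.*-comm (+ e) (+ y)) (sym (ℤP.pos-* y e))) ⟩
    + (y ℕ.* e) ℤ.- 1ℤ           ≡⟨ cong (λ i → + i ℤ.- 1ℤ) (sym eq) ⟩
    (1ℤ ℤ.+ + (x ℕ.* p)) ℤ.- 1ℤ  ≡⟨ cong (λ i → (1ℤ ℤ.+ i) ℤ.- 1ℤ) (ℤP.pos-* x p) ⟩
    (1ℤ ℤ.+ + x ℤ.* + p) ℤ.- 1ℤ  ≡⟨ solve 1 (λ z → (con 1ℤ :+ z) :- con 1ℤ := z) refl (+ x ℤ.* + p) ⟩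
    + x ℤ.* + p                  ∎)
    where
    open ≡-Reasoning
    open ℤSolver.+-*-Solver

  infix 4 _≡ₚ_

  record _≡ₚ_ (x y : ℚ) : Set where
    constructor mk≡ₚ
    field congruent : 1ℤ ≼ x - y

  open _≡ₚ_

  ≡ₚ-refl : ∀ {x} → x ≡ₚ x
  ≡ₚ-refl {x} = mk≡ₚ (subst (1ℤ ≼_) (sym (ℚP.+-inverseʳ x)) ≼-0)

  -- The numerator times an inverse f of the denominator modulo p is an integer congruent to y, and
  -- r is its remainder. The witness w satisfies n - r e = p w.
  residue : ∀ {y} → Integral y → ∃ λ r → r < p × y ≡ₚ fromℕℚ r
  residue {y} (mk≤ᵛ n e p∤e eq) with inverse-mod p∤e
  ... | f , k , ef = r , ℤDM.n%ℕd<d (n ℤ.* f) p , mk≡ₚ (≤ᵛ⇒≼ (mk≤ᵛ w e p∤e (begin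
    (y - fromℕℚ r) * E                ≡⟨ solve 3 (λ y r e → (y :- r) :* e := y :* e :- r :* e) refl y (fromℕℚ r) E ⟩
    y * E - fromℕℚ r * E              ≡⟨ cong₂ _-_ (trans eq (ℚP.*-identityˡ (fromℤ n))) (sym (fromℤ-* (+ r) (+ e))) ⟩
    fromℤ n - fromℤ (+ r ℤ.* + e)     ≡⟨ cong (λ z → fromℤ n ℚ.+ z) (sym (fromℤ-neg (+ r ℤ.* + e))) ⟩
    fromℤ n + fromℤ (ℤ.- (+ r ℤ.* + e))  ≡⟨ sym (fromℤ-+ n (ℤ.- (+ r ℤ.* + e))) ⟩
    fromℤ (n ℤ.- + r ℤ.* + e)         ≡⟨ cong fromℤ numerator ⟩
    fromℤ (+ (p ℕ.^ 1) ℤ.* w)         ≡⟨ fromℤ-* (+ (p ℕ.^ 1)) w ⟩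
    pow 1 * fromℤ w                   ∎)))
    where
    open ≡-Reasoning
    open +-*-Solver
    instance _ = prime⇒nonZero isPrime
    E = fromℕℚ e
    r = (n ℤ.* f) ℤDM.%ℕ p
    q = (n ℤ.* f) ℤDM./ℕ p
    w = q ℤ.* + e ℤ.- n ℤ.* k
    numerator : n ℤ.- + r ℤ.* + e ≡ + (p ℕ.^ 1) ℤ.* w
    numerator = begin
      n ℤ.- + r ℤ.* + e
        -- The product q p is added and subtracted so that division with remainder can turn r + q p
        -- into n f.
        ≡⟨ ℤS.solve 4 (λ n r e x → n ℤS.:- r ℤS.:* e ℤS.:= n ℤS.:- (r ℤS.:+ x ℤS.:- x) ℤS.:* e) refl n (+ r)
            (+ e) (q ℤ.* + p) ⟩
      n ℤ.- (+ r ℤ.+ q ℤ.* + p ℤ.- q ℤ.* + p) ℤ.* + e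
        ≡⟨ cong (λ z → n ℤ.- (z ℤ.- q ℤ.* + p) ℤ.* + e) (sym (ℤDM.a≡a%ℕn+[a/ℕn]*n (n ℤ.* f) p)) ⟩
      n ℤ.- (n ℤ.* f ℤ.- q ℤ.* + p) ℤ.* + e
        ≡⟨ ℤS.solve 5 (λ n f q p e → n ℤS.:- (n ℤS.:* f ℤS.:- q ℤS.:* p) ℤS.:* e ℤS.:=
             p ℤS.:* q ℤS.:* e ℤS.:- n ℤS.:* (e ℤS.:* f ℤS.:- ℤS.con 1ℤ)) refl n f q (+ p) (+ e) ⟩
      + p ℤ.* q ℤ.* + e ℤ.- n ℤ.* (+ e ℤ.* f ℤ.- 1ℤ)
        ≡⟨ cong (λ z → + p ℤ.* q ℤ.* + e ℤ.- n ℤ.* z) ef ⟩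
      + p ℤ.* q ℤ.* + e ℤ.- n ℤ.* (k ℤ.* + p)
        ≡⟨ ℤS.solve 5 (λ n k q p e → p ℤS.:* q ℤS.:* e ℤS.:- n ℤS.:* (k ℤS.:* p) ℤS.:=
             p ℤS.:* (q ℤS.:* e ℤS.:- n ℤS.:* k)) refl n k q (+ p) (+ e) ⟩
      + p ℤ.* w
        ≡⟨ cong (λ z → + z ℤ.* w) (sym (ℕP.*-identityʳ p)) ⟩
      + (p ℕ.^ 1) ℤ.* w ∎
      where
      module ℤS = ℤSolver.+-*-Solver

  Integral⇒0≼ : ∀ {x} → Integral x → 0ℤ ≼ x
  Integral⇒0≼ = ≤ᵛ⇒≼

  ≡ₚ-+ : ∀ {x x′ y y′} → x ≡ₚ x′ → y ≡ₚ y′ → x + y ≡ₚ x′ + y′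
  ≡ₚ-+ {x} {x′} {y} {y′} (mk≡ₚ e) (mk≡ₚ e′) = mk≡ₚ (subst (1ℤ ≼_)
    (solve 4 (λ x x′ y y′ → (x :- x′) :+ (y :- y′) := (x :+ y) :- (x′ :+ y′)) refl x x′ y y′) (≼-+ e e′))
    where open +-*-Solver

  -- The difference of the products is x (y - y′) + (x - x′) y′, which is why integrality is asked
  -- of x and y′.
  ≡ₚ-* : ∀ {x x′ y y′} → Integral x → Integral y′ → x ≡ₚ x′ → y ≡ₚ y′ → x * y ≡ₚ x′ * y′
  ≡ₚ-* {x} {x′} {y} {y′} ix iy′ (mk≡ₚ e) (mk≡ₚ e′) = mk≡ₚ (subst (1ℤ ≼_)
    (solve 4 (λ x x′ y y′ → x :* (y :- y′) :+ (x :- x′) :* y′ := x :* y :- x′ :* y′) refl x x′ y y′)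
    (≼-+ (≼-* (Integral⇒0≼ ix) e′) (≼-* e (Integral⇒0≼ iy′))))
    where open +-*-Solver

  ≡ₚ-^ : ∀ {x r} n → Integral x → x ≡ₚ fromℕℚ r → x ^ n ≡ₚ fromℕℚ (r ℕ.^ n)
  ≡ₚ-^ {x} {r} zero    ix e = ≡ₚ-refl
  ≡ₚ-^ {x} {r} (suc n) ix e = subst (x * x ^ n ≡ₚ_) (sym (fromℕℚ-* r (r ℕ.^ n)))
    (≡ₚ-* ix (fromℤ-integral (+ (r ℕ.^ n))) e (≡ₚ-^ n ix e))

  Unit-fromℕℚ : ∀ {n} → p ℕD.∤ n → Unit (fromℕℚ n)
  Unit-fromℕℚ {n} p∤n = mkUnit (+ n) 1 (p∤⇒∤ p∤n) p∤1 (ℚP.*-identityʳ (fromℕℚ n))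

  Unit⇒Exact : ∀ {u} → Unit u → Exact 0ℤ u
  Unit⇒Exact {u} unit = mkExact u unit (sym (ℚP.*-identityˡ u))

  ≡ₚ-Unit : ∀ {x n} → p ℕD.∤ n → x ≡ₚ fromℕℚ n → Exact 0ℤ x
  ≡ₚ-Unit {x} {n} p∤n (mk≡ₚ e) = subst (Exact 0ℤ)
    (solve 2 (λ n x → n :+ (x :- n) := x) refl (fromℕℚ n) x)
    (Exact-+ (Unit⇒Exact (Unit-fromℕℚ p∤n)) e)
    where open +-*-Solver

  prime∣^ : ∀ {r} n → p ℕD.∣ r ℕ.^ n → p ℕD.∣ r
  prime∣^ zero    d = contradiction d p∤1
  prime∣^ {r} (suc n) d = [ (λ z → z) , prime∣^ n ]′ (euclidsLemma r (r ℕ.^ n) isPrime d)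

  -- For each t a root would be a nonzero residue r, and r determines t, so
  -- rooted values of t inject into the p - 1 nonzero residues.
  rootless-mod : ∀ A C m d → p ℕD.∤ C → 0 < m → 0 < d →
    ∃ λ t → ∀ r → r < p → p ℕD.∤ (C ℕ.+ (t ℕ.* r ℕ.^ m ℕ.+ A ℕ.* r ℕ.^ d))
  rootless-mod A C m d p∤C 0<m 0<d
    with FinP.any? (λ t → ¬? (FinP.any? (λ r → p ℕD.∣? value (toℕ t) (toℕ r))))
    where
    value : ℕ → ℕ → ℕ
    value t r = C ℕ.+ (t ℕ.* r ℕ.^ m ℕ.+ A ℕ.* r ℕ.^ d)
  ... | yes (t , ¬root) = toℕ t , λ r r<p d∣ → ¬root
    (Fin.fromℕ< r<p , subst (λ s → p ℕD.∣ (C ℕ.+ (toℕ t ℕ.* s ℕ.^ m ℕ.+ A ℕ.* s ℕ.^ d)))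
        (sym (FinP.toℕ-fromℕ< r<p)) d∣)
  ... | no all-rooted = ⊥-elim (collide (ℕ.pred p) (ℕP.suc-pred p {{prime⇒nonZero isPrime}}))
    where
    value : ℕ → ℕ → ℕ
    value t r = C ℕ.+ (t ℕ.* r ℕ.^ m ℕ.+ A ℕ.* r ℕ.^ d)

    rooted : ∀ (t : Fin p) → ∃ λ (r : Fin p) → p ℕD.∣ value (toℕ t) (toℕ r)
    rooted t with FinP.any? (λ r → p ℕD.∣? value (toℕ t) (toℕ r))
    ... | yes root = root
    ... | no ¬root = contradiction (t , ¬root) all-rooted

    0^ : ∀ {n} → 0 < n → 0 ℕ.^ n ≡ 0
    0^ (s≤s _) = refl

    nonzero : ∀ {t r} → p ℕD.∣ value t r → r ≢ 0
    nonzero {t} d∣ refl = p∤C (subst (p ℕD.∣_) (begin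
      C ℕ.+ (t ℕ.* 0 ℕ.^ m ℕ.+ A ℕ.* 0 ℕ.^ d)  ≡⟨ cong₂ (λ x y → C ℕ.+ (t ℕ.* x ℕ.+ A ℕ.* y)) (0^ 0<m) (0^ 0<d) ⟩
      C ℕ.+ (t ℕ.* 0 ℕ.+ A ℕ.* 0)              ≡⟨ cong₂ (λ x y → C ℕ.+ (x ℕ.+ y)) (ℕP.*-zeroʳ t) (ℕP.*-zeroʳ A) ⟩
      C ℕ.+ 0                                  ≡⟨ ℕP.+-identityʳ C ⟩
      C                                        ∎) d∣)
      where open ≡-Reasoning

    -- A common root r would make p divide (t - s) r^m, but t - s and r both lie strictly between 0
    -- and p.
    determines : ∀ {s t r} → s < t → t < p → r < p → p ℕD.∣ value s r → ¬ (p ℕD.∣ value t r)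
    determines {s} {t} {r} s<t t<p r<p ds dt =
      [ (λ p∣t-s → ℕD.>⇒∤ {{ℕ.>-nonZero (ℕP.m<n⇒0<n∸m s<t)}} (ℕP.≤-<-trans (ℕP.m∸n≤m t s) t<p) p∣t-s)
      , (λ p∣r^m → ℕD.>⇒∤ {{ℕ.≢-nonZero (nonzero {s} ds)}} r<p (prime∣^ m p∣r^m))
      ]′ (euclidsLemma (t ℕ.∸ s) (r ℕ.^ m) isPrime (ℕD.∣m+n∣m⇒∣n (subst (p ℕD.∣_) split dt) ds))
      where
      open ≡-Reasoning
      split : value t r ≡ value s r ℕ.+ (t ℕ.∸ s) ℕ.* r ℕ.^ m
      split = begin
        C ℕ.+ (t ℕ.* r ℕ.^ m ℕ.+ A ℕ.* r ℕ.^ d)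
          ≡⟨ cong (λ z → C ℕ.+ (z ℕ.* r ℕ.^ m ℕ.+ A ℕ.* r ℕ.^ d)) (sym (ℕP.m+[n∸m]≡n (ℕP.<⇒≤ s<t))) ⟩
        C ℕ.+ ((s ℕ.+ (t ℕ.∸ s)) ℕ.* r ℕ.^ m ℕ.+ A ℕ.* r ℕ.^ d)
          ≡⟨ solve 5 (λ c s k x y → c :+ ((s :+ k) :* x :+ y) := c :+ (s :* x :+ y) :+ k :* x) refl
               C s (t ℕ.∸ s) (r ℕ.^ m) (A ℕ.* r ℕ.^ d) ⟩
        value s r ℕ.+ (t ℕ.∸ s) ℕ.* r ℕ.^ m ∎
        where open ℕSolver.+-*-Solver

    collide : ∀ n → suc n ≡ p → ⊥
    collide n refl = determines i<j (FinP.toℕ<n j) (FinP.toℕ<n (proj₁ (rooted i))) (proj₂ (rooted i))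
      (subst (λ r → p ℕD.∣ value (toℕ j) (toℕ r)) (sym (FinP.punchOut-injective (root≢0 i) (root≢0 j) eq))
          (proj₂ (rooted j)))
      where
      root≢0 : ∀ t → zero ≢ proj₁ (rooted t)
      root≢0 t e = nonzero {toℕ t} (proj₂ (rooted t)) (cong toℕ (sym e))
      collision = FinP.pigeonhole (ℕP.n<1+n n) (λ t → punchOut (root≢0 t))
      i   = proj₁ collision
      j   = proj₁ (proj₂ collision)
      i<j = proj₁ (proj₂ (proj₂ collision))
      eq  = proj₂ (proj₂ (proj₂ collision))

-- Rational values of polynomials

term : ∀ {n} → Vec ℚ n → ℚ → Fin n → ℚ
term a x i = lookup a i * x ^ toℕ i

evalℚ : ∀ {n} → Vec ℚ n → ℚ → ℚ
evalℚ a x = sum (term a x)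

0^suc : ∀ n → 0ℚ ^ suc n ≡ 0ℚ
0^suc n = ℚP.*-zeroˡ (0ℚ ^ n)

term-0 : ∀ {n} (a : Vec ℚ (suc n)) x → term a x zero ≡ lookup a zero
term-0 a x = ℚP.*-identityʳ (lookup a zero)

term-update : ∀ {n} (a : Vec ℚ n) x i v → term (a [ i ]≔ v) x i ≡ v * x ^ toℕ i
term-update a x i v = cong (_* x ^ toℕ i) (VecP.lookup∘update i a v)

term-update′ : ∀ {n} (a : Vec ℚ n) x {i j} v → j ≢ i → term (a [ i ]≔ v) x j ≡ term a x j
term-update′ a x {i} {j} v j≢i = cong (_* x ^ toℕ j) (VecP.lookup∘update′ j≢i a v)

-- A value is affine in each single coefficient. This is the equation that Wanda solves for her last
-- one.
evalℚ-update : ∀ {n} (a : Vec ℚ n) x i v →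
  evalℚ (a [ i ]≔ v) x ≡ v * x ^ toℕ i + evalℚ (a [ i ]≔ 0ℚ) x
evalℚ-update {suc n} a x i v = begin
  sum (term (a [ i ]≔ v) x)
    ≡⟨ sum-remove {i = i} (term (a [ i ]≔ v) x) ⟩
  term (a [ i ]≔ v) x i + sum (removeAt (term (a [ i ]≔ v) x) i)
    ≡⟨ cong₂ _+_ (term-update a x i v) (others v) ⟩
  v * x ^ toℕ i + rest
    ≡⟨ cong (v * x ^ toℕ i ℚ.+_) (sym (trans (cong₂ _+_ (trans (term-update a x i 0ℚ) (ℚP.*-zeroˡ (x ^ toℕ i)))
        (others 0ℚ)) (ℚP.+-identityˡ rest))) ⟩
  v * x ^ toℕ i + (term (a [ i ]≔ 0ℚ) x i + sum (removeAt (term (a [ i ]≔ 0ℚ) x) i))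
    ≡⟨ cong (v * x ^ toℕ i ℚ.+_) (sym (sum-remove {i = i} (term (a [ i ]≔ 0ℚ) x))) ⟩
  v * x ^ toℕ i + evalℚ (a [ i ]≔ 0ℚ) x ∎
  where
  open ≡-Reasoning
  rest = sum (removeAt (term a x) i)
  others : ∀ w → sum (removeAt (term (a [ i ]≔ w) x) i) ≡ rest
  others w = sum-cong-≗ λ j → term-update′ a x w (FinP.punchInᵢ≢i i j)

sum-zero : ∀ {n} (t : Fin n → ℚ) → (∀ i → t i ≡ 0ℚ) → sum t ≡ 0ℚ
sum-zero {n} t z = trans (sum-cong-≗ z) (sum-replicate-zero n)

sum-single : ∀ {n} (t : Fin n → ℚ) i → (∀ k → k ≢ i → t k ≡ 0ℚ) → sum t ≡ t i
sum-single {suc n} t i z = trans (sum-remove {i = i} t)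
  (trans (cong (λ s → t i ℚ.+ s) (sum-zero (removeAt t i) λ k → z _ (FinP.punchInᵢ≢i i k))) (ℚP.+-identityʳ (t i)))

sum-pair : ∀ {n} (t : Fin n → ℚ) {i j} → i ≢ j → (∀ k → k ≢ i → k ≢ j → t k ≡ 0ℚ) → sum t ≡ t i + t j
sum-pair {suc n} t {i} {j} i≢j z = trans (sum-remove {i = i} t) (cong (λ s → t i ℚ.+ s)
  (trans (sum-single (removeAt t i) (punchOut i≢j) λ k k≢ → z _ (FinP.punchInᵢ≢i i k)
    λ e → k≢ (FinP.punchIn-injective i k _ (trans e (sym (FinP.punchIn-punchOut i≢j)))))
    (cong t (FinP.punchIn-punchOut i≢j))))

-- The Horner step, along which `nonvanishing` proceeds by induction.
evalℚ-∷ : ∀ {n} c (a : Vec ℚ n) x → evalℚ (c ∷ a) x ≡ c + x * evalℚ a x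
evalℚ-∷ c a x = cong₂ _+_ (ℚP.*-identityʳ c) (factor a)
  where
  open +-*-Solver
  factor : ∀ {n} (a : Vec ℚ n) → sum (λ i → lookup a i * x ^ suc (toℕ i)) ≡ x * evalℚ a x
  factor a = go (λ i → term a x i) (λ i → solve 3 (λ u v w → u :* (v :* w) := v :* (u :* w)) refl (lookup a i) x
      (x ^ toℕ i))
    where
    go : ∀ {n} (t : Fin n → ℚ) {u : Fin n → ℚ} → (∀ i → u i ≡ x * t i) → sum u ≡ x * sum t
    go {zero}  t e = sym (ℚP.*-zeroʳ x)
    go {suc n} t e = trans (cong₂ _+_ (e zero) (go (λ i → t (suc i)) (λ i → e (suc i))))
      (sym (ℚP.*-distribˡ-+ x (t zero) (sum (λ i → t (suc i)))))

-- Roots in ℚₚ and values at rational arguments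

module Roots {p : ℕ} (isPrime : Prime p) where

  open Padic isPrime using (ℚₚ; seq; fromℚ; commutativeRing; mk≈; pointwise)
  open Valuation isPrime
  private
    module ℚₚR = CommutativeRing commutativeRing
    module RS = RawSemiringDefinitions (Semiring.rawSemiring ℚₚR.semiring)

  seq-^ : ∀ x k n → seq (x RS.^ k) n ≡ seq x n ^ k
  seq-^ x zero    n = refl
  seq-^ x (suc k) n = cong (seq x n *_) (seq-^ x k n)

  seq-sum : ∀ {m} (f : Fin m → ℚₚ) n → seq (RS.sum f) n ≡ sum (λ i → seq (f i) n)
  seq-sum {zero}  f n = refl
  seq-sum {suc m} f n = cong (λ s → seq (f zero) n ℚ.+ s) (seq-sum (λ i → f (suc i)) n)

  seq-eval : ∀ {m} (a : Vec ℚ m) x n → seq (eval isPrime a x) n ≡ evalℚ a (seq x n)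
  seq-eval a x n = trans (seq-sum (λ i → fromℚ (lookup a i) ℚₚR.* x RS.^ toℕ i) n)
    (sum-cong-≗ λ i → cong (lookup a i *_) (seq-^ x (toℕ i) n))

  Rootless : ∀ {m} → Vec ℚ m → Set
  Rootless a = ∃ λ K → ∀ q → ¬ (K ≼ evalℚ a q)

  -- Along the Cauchy sequence of a root the values tend to zero, so one of them reaches valuation
  -- |K|, which is at least K.
  Rootless⇒¬HasRoot : ∀ {ℓ m} (D : Subring commutativeRing ℓ) {a : Vec ℚ m} → Rootless a → ¬ HasRootIn isPrime D a
  Rootless⇒¬HasRoot D {a} (K , small) (x , _ , mk≈ root) = let N , f = root ℤ.∣ K ∣ in
    small (seq x N) (≼-weaken (i≤+∣i∣ K) (subst (λ y → + ℤ.∣ K ∣ ≼ y)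
      (trans (ℚP.+-identityʳ _) (seq-eval a x N)) (≤ᵛ⇒≼ (f N ℕP.≤-refl))))

  -- Natural numbers are sums of ones and hence lie in every unital subring.
  root⇒HasRoot : ∀ {ℓ m} (D : Subring commutativeRing ℓ) {a : Vec ℚ m} n → evalℚ a (fromℕℚ n) ≡ 0ℚ →
    HasRootIn isPrime D a
  root⇒HasRoot D {a} n e = fromℚ (fromℕℚ n) , member n , pointwise λ k → trans (seq-eval a (fromℚ (fromℕℚ n)) k) e
    where
    open Subring D
    member : ∀ n → Member (fromℚ (fromℕℚ n))
    member zero    = 0-closed
    member (suc n) = resp (pointwise λ _ → sym (fromℕℚ-+ 1 n)) (+-closed 1-closed (member n))

-- Inequalities between integers are reduced to ring identities exhibiting
-- the difference as a sum of products of nonnegative slacks.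
≤-by : ∀ {x y z} → 0ℤ ℤ.≤ z → y ℤ.- x ≡ z → x ℤ.≤ y
≤-by {x} {y} 0≤z e = ℤP.0≤i-j⇒j≤i {y} {x} (subst (0ℤ ℤ.≤_) (sym e) 0≤z)

0≤+ : ∀ {x y} → 0ℤ ℤ.≤ x → 0ℤ ℤ.≤ y → 0ℤ ℤ.≤ x ℤ.+ y
0≤+ = ℤP.+-mono-≤

0≤* : ∀ {x y} → 0ℤ ℤ.≤ x → 0ℤ ℤ.≤ y → 0ℤ ℤ.≤ x ℤ.* y
0≤* {+ m} {+ n} _ _ = subst (0ℤ ℤ.≤_) (ℤP.pos-* m n) (ℤ.+≤+ z≤n)

slack : ∀ {x y} → x ℤ.≤ y → 0ℤ ℤ.≤ y ℤ.- x
slack = ℤP.i≤j⇒0≤j-i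

-- Here s is the valuation of the argument, -M + m s that of the chosen term, and -B + i s a lower
-- bound for any other term. For |s| ≤ 2B, moving by at most d indices costs at most 2dB, which M
-- absorbs. For |s| > 2B, one step away from an end gains at least 2B + 1, enough to get from v ≤ B
-- above to -B. The first two bounds are one-sided in s, so they also serve one side of m beyond the
-- window.
module Inequalities (B M d s : ℤ) (0≤B : 0ℤ ℤ.≤ B) where

  open ℤSolver.+-*-Solver
  private
    two = + 2

  middle-beats-right : two ℤ.* d ℤ.* B ℤ.+ B ℤ.+ 1ℤ ℤ.≤ M → ℤ.- (two ℤ.* B) ℤ.≤ s →
    ∀ {m i} → m ℤ.≤ i → i ℤ.- m ℤ.≤ d → 1ℤ ℤ.+ (ℤ.- M ℤ.+ m ℤ.* s) ℤ.≤ ℤ.- B ℤ.+ i ℤ.* s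
  middle-beats-right large s≥ {m} {i} m≤i i-m≤d =
    ≤-by (0≤+ (0≤+ (slack large) (0≤* (0≤* {two} (ℤ.+≤+ z≤n) 0≤B) (slack i-m≤d))) (0≤* (slack m≤i) (slack s≥)))
      (solve 6 (λ B M d s m i →
        (:- B :+ i :* s) :- (con 1ℤ :+ (:- M :+ m :* s)) :=
        (M :- (con two :* d :* B :+ B :+ con 1ℤ)) :+ con two :* B :* (d :- (i :- m)) :+ (i :- m) :*
            (s :- (:- (con two :* B))))
        refl B M d s m i)

  middle-beats-left : two ℤ.* d ℤ.* B ℤ.+ B ℤ.+ 1ℤ ℤ.≤ M → s ℤ.≤ two ℤ.* B →
    ∀ {m i} → i ℤ.≤ m → m ℤ.- i ℤ.≤ d → 1ℤ ℤ.+ (ℤ.- M ℤ.+ m ℤ.* s) ℤ.≤ ℤ.- B ℤ.+ i ℤ.* s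
  middle-beats-left large s≤ {m} {i} i≤m m-i≤d =
    ≤-by (0≤+ (0≤+ (slack large) (0≤* (0≤* {two} (ℤ.+≤+ z≤n) 0≤B) (slack m-i≤d))) (0≤* (slack i≤m) (slack s≤)))
      (solve 6 (λ B M d s m i →
        (:- B :+ i :* s) :- (con 1ℤ :+ (:- M :+ m :* s)) :=
        (M :- (con two :* d :* B :+ B :+ con 1ℤ)) :+ con two :* B :* (d :- (m :- i)) :+ (m :- i) :*
            (con two :* B :- s))
        refl B M d s m i)

  left-beats : ∀ {v} → v ℤ.≤ B → 1ℤ ℤ.+ two ℤ.* B ℤ.≤ s → ∀ {i} → 1ℤ ℤ.≤ i → 1ℤ ℤ.+ v ℤ.≤ ℤ.- B ℤ.+ i ℤ.* s
  left-beats {v} v≤B s≥ {i} 1≤i =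
    ≤-by (0≤+ (0≤+ (slack v≤B) (0≤* (slack 1≤i) (0≤+ (slack s≥)
        (0≤+ {1ℤ} (ℤ.+≤+ z≤n) (0≤* {two} (ℤ.+≤+ z≤n) 0≤B))))) (slack s≥))
      (solve 4 (λ B s v i →
        (:- B :+ i :* s) :- (con 1ℤ :+ v) :=
        (B :- v) :+ (i :- con 1ℤ) :* ((s :- (con 1ℤ :+ con two :* B)) :+ (con 1ℤ :+ con two :* B)) :+
            (s :- (con 1ℤ :+ con two :* B)))
        refl B s v i)

  right-beats : ∀ {v} → v ℤ.≤ B → 1ℤ ℤ.+ s ℤ.≤ ℤ.- (two ℤ.* B) → ∀ {i} → 1ℤ ℤ.+ i ℤ.≤ d →
    1ℤ ℤ.+ (v ℤ.+ d ℤ.* s) ℤ.≤ ℤ.- B ℤ.+ i ℤ.* s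
  right-beats {v} v≤B s≤ {i} i<d =
    ≤-by (0≤+ (0≤+ (slack v≤B) (0≤* (slack i<d) (0≤+ (slack s≤)
        (0≤+ {1ℤ} (ℤ.+≤+ z≤n) (0≤* {two} (ℤ.+≤+ z≤n) 0≤B))))) (slack s≤))
      (solve 5 (λ B d s v i →
        (:- B :+ i :* s) :- (con 1ℤ :+ (v :+ d :* s)) :=
        (B :- v) :+ (d :- (con 1ℤ :+ i)) :* ((:- (con two :* B) :- (con 1ℤ :+ s)) :+ (con 1ℤ :+ con two :* B))
            :+ (:- (con two :* B) :- (con 1ℤ :+ s)))
        refl B d s v i)

-- Domination by one large coefficient

module Dominance {p : ℕ} (isPrime : Prime p) where

  open Valuation isPrime
  open Roots isPrime

  Exact-term : ∀ {n v s} (a : Vec ℚ n) {x} i → Exact v (lookup a i) → Exact s x →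
    Exact (v ℤ.+ + toℕ i ℤ.* s) (term a x i)
  Exact-term a i exa exx = Exact-* exa (Exact-^ (toℕ i) exx)

  ≼-term : ∀ {n v s} (a : Vec ℚ n) {x} i → v ≼ lookup a i → Exact s x → v ℤ.+ + toℕ i ℤ.* s ≼ term a x i
  ≼-term a i b exx = ≼-* b (Exact⇒≼ (Exact-^ (toℕ i) exx))

  -- Zero has no exact valuation and is treated apart: there every term but the constant one
  -- vanishes.
  rootless-if-⋠ : ∀ {d} (a : Vec ℚ (suc d)) {v} → Exact v (lookup a zero) →
    (∀ q s → Exact s q → ¬ (ℤ.suc v ≼ evalℚ a q)) → Rootless a
  rootless-if-⋠ a {v} exv nonzero = ℤ.suc v , small
    where
    ex₀ : Exact v (term a 0ℚ zero)
    ex₀ = subst (Exact v) (sym (term-0 a 0ℚ)) exv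
    at-zero : ∀ i → i ≢ zero → ℤ.suc v ≼ term a 0ℚ i
    at-zero zero    0≢0 = contradiction refl 0≢0
    at-zero (suc i) _   = subst (ℤ.suc v ≼_) (sym (trans (cong (lookup a (suc i) *_) (0^suc (toℕ i)))
        (ℚP.*-zeroʳ (lookup a (suc i))))) ≼-0
    small : ∀ q → ¬ (ℤ.suc v ≼ evalℚ a q)
    small q with q ℚP.≟ 0ℚ
    ... | yes refl = dominated (term a 0ℚ) zero ex₀ zero ex₀ at-zero
    ... | no q≢0   = let s , exs = exact q≢0 in nonzero q s exs

  Dominant : ∀ {n} → Vec ℚ n → ℚ → Set
  Dominant a q = ∃₂ λ j t → Exact t (term a q j) × (∀ i → i ≢ j → ℤ.suc t ≼ term a q i)

  dominant⇒⋠ : ∀ {d} (a : Vec ℚ (suc d)) {v} → Exact v (lookup a zero) → ∀ q → Dominant a q → ¬ (ℤ.suc v ≼ evalℚ a q)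
  dominant⇒⋠ a {v} exv q (j , t , ex , b) = dominated (term a q) zero (subst (Exact v) (sym (term-0 a q)) exv) j ex b

  -- What is required of an end coefficient at distance L from the chosen index. The bound `v≤B`
  -- lets its term win for extreme arguments, and `generic` excludes a tie with the chosen term,
  -- which would express M + v as a multiple of L.
  record End (B M L : ℕ) (x : ℚ) : Set where
    field
      v      : ℤ
      exactly : Exact v x
      v≤B    : v ℤ.≤ + B
      generic : ¬ (+ L ℤD.∣ + M ℤ.+ v)

  module _ {d : ℕ} (a : Vec ℚ (suc d)) (m : Fin (suc d)) (B M : ℕ)
    (large : 2 ℕ.* d ℕ.* B ℕ.+ B ℕ.+ 1 ≤ M)
    (chosen : Exact (ℤ.- + M) (lookup a m))
    (others : ∀ i → ℤ.- + B ≼ lookup a i ⊎ i ≡ m)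
    (left  : zero ≢ m → End B M (toℕ m) (lookup a zero))
    (right : fromℕ d ≢ m → End B M (d ℕ.∸ toℕ m) (lookup a (fromℕ d))) where

    private
      dominant : ∀ q s → Exact s q → Dominant a q
      dominant q s exs = by-cases (s ℤP.≤? + 2 ℤ.* + B) (ℤ.- (+ 2 ℤ.* + B) ℤP.≤? s)
        where
        open Inequalities (+ B) (+ M) (+ d) s (ℤ.+≤+ z≤n)
        open ℤSolver.+-*-Solver
        Tₘ : ℤ
        Tₘ = ℤ.- + M ℤ.+ + toℕ m ℤ.* s
        bound : Fin (suc d) → ℤ
        bound i = ℤ.- + B ℤ.+ + toℕ i ℤ.* s
        exₘ : Exact Tₘ (term a q m)
        exₘ = Exact-term a m chosen exs

        large′ : + 2 ℤ.* + d ℤ.* + B ℤ.+ + B ℤ.+ 1ℤ ℤ.≤ + M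
        large′ = subst (ℤ._≤ + M) (cong (λ z → z ℤ.+ + B ℤ.+ 1ℤ)
            (trans (ℤP.pos-* (2 ℕ.* d) B) (cong (ℤ._* + B) (ℤP.pos-* 2 d)))) (ℤ.+≤+ large)

        lower : ∀ t i → i ≢ m → ℤ.suc t ℤ.≤ bound i → ℤ.suc t ≼ term a q i
        lower t i i≢m t≤ with others i
        ... | inj₁ b   = ≼-weaken t≤ (≼-term a i b exs)
        ... | inj₂ i≡m = contradiction i≡m i≢m

        position : ∀ {i} → i ≢ m → toℕ i < toℕ m ⊎ toℕ m < toℕ i
        position {i} i≢m with ℕP.<-cmp (toℕ i) (toℕ m)
        ... | tri< i<m _ _ = inj₁ i<m
        ... | tri≈ _ i≡m _ = contradiction (FinP.toℕ-injective i≡m) i≢m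
        ... | tri> _ _ m<i = inj₂ m<i

        difference≤d : ∀ i j → + toℕ i ℤ.- + toℕ j ℤ.≤ + d
        difference≤d i j = ≤-by (0≤+ (slack (ℤ.+≤+ (FinP.toℕ≤pred[n] i))) (ℤ.+≤+ {n = toℕ j} z≤n))
          (solve 3 (λ d i j → d :- (i :- j) := d :- i :+ j) refl (+ d) (+ toℕ i) (+ toℕ j))

        on-right : ℤ.- (+ 2 ℤ.* + B) ℤ.≤ s → ∀ i → toℕ m < toℕ i → ℤ.suc Tₘ ℤ.≤ bound i
        on-right s≥ i m<i = middle-beats-right large′ s≥ (ℤ.+≤+ (ℕP.<⇒≤ m<i)) (difference≤d i m)

        on-left : s ℤ.≤ + 2 ℤ.* + B → ∀ i → toℕ i < toℕ m → ℤ.suc Tₘ ℤ.≤ bound i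
        on-left s≤ i i<m = middle-beats-left large′ s≤ (ℤ.+≤+ (ℕP.<⇒≤ i<m)) (difference≤d m i)

        -- The end term and the chosen term do not tie, so the one of smaller valuation dominates.
        -- Any other term that loses to either of them loses to that one.
        against-end : ∀ e {v} → e ≢ m → Exact v (term a q e) → v ≢ Tₘ →
          (∀ i → i ≢ m → i ≢ e → ℤ.suc v ℤ.≤ bound i ⊎ ℤ.suc Tₘ ℤ.≤ bound i) → Dominant a q
        against-end e {v} e≢m exₑ v≢Tₘ beats with ℤP.<-cmp v Tₘ
        ... | tri≈ _ v≡Tₘ _ = contradiction v≡Tₘ v≢Tₘ
        ... | tri< v<Tₘ _ _ = e , v , exₑ , λ i i≢e → smaller i i≢e (i FinP.≟ m)
          where
          smaller : ∀ i → i ≢ e → Dec (i ≡ m) → ℤ.suc v ≼ term a q i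
          smaller i i≢e (yes refl) = ≼-weaken (ℤP.i<j⇒suc[i]≤j v<Tₘ) (Exact⇒≼ exₘ)
          smaller i i≢e (no i≢m)   = lower v i i≢m
            ([ (λ b → b) , ℤP.≤-trans (ℤP.suc-mono (ℤP.<⇒≤ v<Tₘ)) ]′ (beats i i≢m i≢e))
        ... | tri> _ _ Tₘ<v = m , Tₘ , exₘ , λ i i≢m → smaller i i≢m (i FinP.≟ e)
          where
          smaller : ∀ i → i ≢ m → Dec (i ≡ e) → ℤ.suc Tₘ ≼ term a q i
          smaller i i≢m (yes refl) = ≼-weaken (ℤP.i<j⇒suc[i]≤j Tₘ<v) (Exact⇒≼ exₑ)
          smaller i i≢m (no i≢e)   = lower Tₘ i i≢m
            ([ ℤP.≤-trans (ℤP.suc-mono (ℤP.<⇒≤ Tₘ<v)) , (λ b → b) ]′ (beats i i≢m i≢e))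

        -2B≤2B : ℤ.- (+ 2 ℤ.* + B) ℤ.≤ + 2 ℤ.* + B
        -2B≤2B = ≤-by (0≤* {+ 4} {+ B} (ℤ.+≤+ z≤n) (ℤ.+≤+ z≤n))
          (solve 1 (λ B → con (+ 2) :* B :- (:- (con (+ 2) :* B)) := con (+ 4) :* B) refl (+ B))

        large-s : + 2 ℤ.* + B ℤ.< s → Dec (zero ≡ m) → Dominant a q
        large-s 2B<s (yes refl) = m , Tₘ , exₘ , λ i i≢m → lower Tₘ i i≢m
          ([ (λ ()) , on-right (ℤP.≤-trans -2B≤2B (ℤP.<⇒≤ 2B<s)) i ]′ (position i≢m))
        large-s 2B<s (no 0≢m) = against-end zero 0≢m
          (subst (Exact v) (sym (term-0 a q)) exactly)
          (λ v≡Tₘ → generic (ℤD.divides s (trans (cong (λ v → + M ℤ.+ v) v≡Tₘ)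
            (solve 3 (λ M m s → M :+ (:- M :+ m :* s) := s :* m) refl (+ M) (+ toℕ m) s))))
          λ i i≢m i≢0 → [ (λ _ → inj₁ (left-beats v≤B (ℤP.i<j⇒suc[i]≤j 2B<s) (positive i i≢0)))
            , (λ m<i → inj₂ (on-right (ℤP.≤-trans -2B≤2B (ℤP.<⇒≤ 2B<s)) i m<i)) ]′ (position i≢m)
          where
          open End (left 0≢m)
          positive : ∀ i → i ≢ zero → 1ℤ ℤ.≤ + toℕ i
          positive zero    0≢0 = contradiction refl 0≢0
          positive (suc i) _   = ℤ.+≤+ (s≤s z≤n)

        small-s : s ℤ.< ℤ.- (+ 2 ℤ.* + B) → Dec (fromℕ d ≡ m) → Dominant a q
        small-s s<-2B (yes refl) = m , Tₘ , exₘ , λ i i≢m → lower Tₘ i i≢m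
          ([ on-left (ℤP.≤-trans (ℤP.<⇒≤ s<-2B) -2B≤2B) i
           , (λ d<i → contradiction (FinP.toℕ≤pred[n] i) (ℕP.<⇒≱ (subst (_< toℕ i) (FinP.toℕ-fromℕ d) d<i))) ]′
               (position i≢m))
        small-s s<-2B (no d≢m) = against-end (fromℕ d) d≢m
          (subst (λ k → Exact (v ℤ.+ + k ℤ.* s) (term a q (fromℕ d))) (FinP.toℕ-fromℕ d)
              (Exact-term a (fromℕ d) exactly exs))
          (λ v≡Tₘ → generic (ℤD.divides (ℤ.- s) (begin
            + M ℤ.+ v
              ≡⟨ solve 4 (λ M v d s → M :+ v := M :+ (v :+ d :* s) :- d :* s) refl (+ M) v (+ d) s ⟩
            + M ℤ.+ (v ℤ.+ + d ℤ.* s) ℤ.- + d ℤ.* s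
              ≡⟨ cong (λ t → + M ℤ.+ t ℤ.- + d ℤ.* s) v≡Tₘ ⟩
            + M ℤ.+ Tₘ ℤ.- + d ℤ.* s
              ≡⟨ solve 4 (λ M m d s → M :+ (:- M :+ m :* s) :- d :* s := :- s :* (d :- m)) refl (+ M) (+ toℕ m)
                  (+ d) s ⟩
            ℤ.- s ℤ.* (+ d ℤ.- + toℕ m)
              ≡⟨ cong (ℤ.- s ℤ.*_) (trans (ℤP.m-n≡m⊖n d (toℕ m)) (ℤP.⊖-≥ (FinP.toℕ≤pred[n] m))) ⟩
            ℤ.- s ℤ.* + (d ℕ.∸ toℕ m) ∎)))
          λ i i≢m i≢d → [ (λ i<m → inj₂ (on-left (ℤP.≤-trans (ℤP.<⇒≤ s<-2B) -2B≤2B) i i<m))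
            , (λ _ → inj₁ (right-beats v≤B (ℤP.i<j⇒suc[i]≤j s<-2B) {+ toℕ i}
                (ℤ.+≤+ (ℕP.≤∧≢⇒< (FinP.toℕ≤pred[n] i) λ i≡d → i≢d
                    (FinP.toℕ-injective (trans i≡d (sym (FinP.toℕ-fromℕ d)))))))) ]′ (position i≢m)
          where
          open End (right d≢m)
          open ≡-Reasoning

        -- For |s| ≤ 2B the chosen term dominates; beyond that, an end term beats all
        -- the terms on its side of m, and the chosen term those on the other side.
        by-cases : Dec (s ℤ.≤ + 2 ℤ.* + B) → Dec (ℤ.- (+ 2 ℤ.* + B) ℤ.≤ s) → Dominant a q
        by-cases (yes s≤2B) (yes -2B≤s) = m , Tₘ , exₘ , λ i i≢m → lower Tₘ i i≢m
          ([ on-left s≤2B i , on-right -2B≤s i ]′ (position i≢m))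
        by-cases (no s≰2B) _            = large-s (ℤP.≰⇒> s≰2B) (zero FinP.≟ m)
        by-cases (yes _) (no -2B≰s)     = small-s (ℤP.≰⇒> -2B≰s) (fromℕ d FinP.≟ m)

      constant : Dec (zero ≡ m) → ∃ λ v → Exact v (lookup a zero)
      constant (yes refl) = ℤ.- + M , chosen
      constant (no 0≢m)   = End.v (left 0≢m) , End.exactly (left 0≢m)

    rootless-by-large-term : Rootless a
    rootless-by-large-term = rootless-if-⋠ a (proj₂ (constant (zero FinP.≟ m)))
      λ q s exs → dominant⇒⋠ a (proj₂ (constant (zero FinP.≟ m))) q (dominant q s exs)

-- Nora's last coefficient

-- P misses one of any two neighbours and Q two of any three, so some n ≤ 3 escapes both. With
-- spacing 2 on both sides, P and Q could be the even and the odd numbers; hence one distance has to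
-- be at least 3.
avoid-both : ∀ {P Q : ℕ → Set} → (∀ n → Dec (P n)) → (∀ n → Dec (Q n)) →
  (∀ n → P n → ¬ P (1 ℕ.+ n)) → (∀ n → Q n → ¬ Q (1 ℕ.+ n)) → (∀ n → Q n → ¬ Q (2 ℕ.+ n)) →
  ∃ λ n → ¬ P n × ¬ Q n
avoid-both {P} {Q} P? Q? P₁ Q₁ Q₂ with P? 0 | P? 1 | P? 2 | Q? 0 | Q? 1
... | no ¬p | _      | _      | no ¬q | _      = 0 , ¬p , ¬q
... | no _  | no ¬p  | _      | yes q | _      = 1 , ¬p , Q₁ 0 q
... | no _  | yes p  | _      | yes q | _      = 2 , P₁ 1 p , Q₂ 0 q
... | yes p | _      | _      | _     | no ¬q  = 1 , P₁ 0 p , ¬q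
... | yes _ | _      | no ¬p  | _     | yes q  = 2 , ¬p , Q₁ 1 q
... | yes _ | _      | yes p  | _     | yes q  = 3 , P₁ 2 p , Q₂ 1 q

∤-shift : ∀ {L k x y} → 0 < k → k < L → y ≡ + k ℤ.+ x → + L ℤD.∣ x → ¬ (+ L ℤD.∣ y)
∤-shift {k = k} 0<k k<L refl L∣x L∣y =
  ℕD.>⇒∤ {{ℕ.>-nonZero 0<k}} k<L (ℤD.∣⇒∣ᵤ (ℤD.∣m+n∣n⇒∣m {m = + k} L∣y L∣x))

-- In a trinomial whose end terms tie at the valuation e, the term of index k has valuation at least
-- v + k (s - e). This grows with k for s > e, in favour of the constant term, and falls for s < e,
-- in favour of the leading one (`last-beats`).
first-beats : ∀ {k v s e} → 1ℤ ℤ.≤ k → e ℤ.< s → ℤ.suc v ℤ.≤ v ℤ.+ k ℤ.* (s ℤ.- e)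
first-beats {k} {v} {s} {e} 1≤k e<s =
  ≤-by (0≤+ (0≤* (slack 1≤k) (slack (ℤP.<⇒≤ e<s))) (slack (ℤP.i<j⇒suc[i]≤j e<s)))
    (solve 4 (λ k v s e → v :+ k :* (s :- e) :- (con 1ℤ :+ v) := (k :- con 1ℤ) :* (s :- e) :+
        (s :- (con 1ℤ :+ e))) refl k v s e)
  where open ℤSolver.+-*-Solver

last-beats : ∀ {k l v s e} → ℤ.suc k ℤ.≤ l → s ℤ.< e → ℤ.suc (v ℤ.+ l ℤ.* (s ℤ.- e)) ℤ.≤ v ℤ.+ k ℤ.* (s ℤ.- e)
last-beats {k} {l} {v} {s} {e} k<l s<e =
  ≤-by (0≤+ (0≤* (slack k<l) (slack (ℤP.<⇒≤ s<e))) (slack (ℤP.i<j⇒suc[i]≤j s<e)))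
    (solve 5 (λ k l v s e → v :+ k :* (s :- e) :- (con 1ℤ :+ (v :+ l :* (s :- e))) :=
      (l :- (con 1ℤ :+ k)) :* (e :- s) :+ (e :- (con 1ℤ :+ s))) refl k l v s e)
  where open ℤSolver.+-*-Solver

module LastMoves {p : ℕ} (isPrime : Prime p) where

  open Valuation isPrime
  open Residues isPrime
  open Roots isPrime
  open Dominance isPrime

  uniform-lower-bound : ∀ {n} (a : Vec ℚ n) → ∃ λ B → ∀ i → ℤ.- + B ≼ lookup a i
  uniform-lower-bound []      = 0 , λ ()
  uniform-lower-bound (c ∷ a) =
    let s , b = lower-bound c
        B , f = uniform-lower-bound a
    in ℤ.∣ s ∣ ℕ.+ B , λ where
      zero    → ≼-weaken (ℤP.≤-trans (ℤP.neg-mono-≤ (ℤ.+≤+ (ℕP.m≤m+n ℤ.∣ s ∣ B))) (-∣∣≤ s)) b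
      (suc i) → ≼-weaken (ℤP.neg-mono-≤ (ℤ.+≤+ (ℕP.m≤n+m B ℤ.∣ s ∣))) (f i)
    where
    -∣∣≤ : ∀ s → ℤ.- + ℤ.∣ s ∣ ℤ.≤ s
    -∣∣≤ s = subst (ℤ.- + ℤ.∣ s ∣ ℤ.≤_) (ℤP.neg-involutive s)
      (ℤP.neg-mono-≤ (subst (λ k → ℤ.- s ℤ.≤ + k) (ℤP.∣-i∣≡∣i∣ s) (i≤+∣i∣ (ℤ.- s))))

  module _ {d : ℕ} (a : Vec ℚ (suc d)) (m : Fin (suc d))
    (left  : zero ≢ m → lookup a zero ≢ 0ℚ × 2 ≤ toℕ m)
    (right : fromℕ d ≢ m → lookup a (fromℕ d) ≢ 0ℚ × 2 ≤ d ℕ.∸ toℕ m)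
    (not-both-2 : zero ≢ m → fromℕ d ≢ m → 3 ≤ toℕ m ⊎ 3 ≤ d ℕ.∸ toℕ m) where

    private
      valuation : ∀ e → (e ≢ m → lookup a e ≢ 0ℚ) → ∃ λ v → e ≢ m → Exact v (lookup a e)
      valuation e nonzero with e FinP.≟ m
      -- A dummy value: an end that is itself the chosen index imposes no condition.
      ... | yes e≡m = 0ℤ , λ e≢m → contradiction e≡m e≢m
      ... | no e≢m  = let v , ex = exact (nonzero e≢m) in v , λ _ → ex

      B₀ = proj₁ (uniform-lower-bound a)
      v₀ = proj₁ (valuation zero (λ e≢m → proj₁ (left e≢m)))
      vₑ = proj₁ (valuation (fromℕ d) (λ e≢m → proj₁ (right e≢m)))
      -- B has to bound all coefficients from below and both end valuations from above; `M₀` is the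
      -- threshold of the two middle inequalities.
      B  = B₀ ℕ.+ (ℤ.∣ v₀ ∣ ℕ.+ ℤ.∣ vₑ ∣)
      M₀ = 2 ℕ.* d ℕ.* B ℕ.+ B ℕ.+ 1

      -- The terms of index m and e tie at some valuation of the argument exactly if
      -- |e - m| divides M + v(aₑ).
      Resonant : ℕ → ℤ → ℕ → Set
      Resonant L v n = + L ℤD.∣ + (n ℕ.+ M₀) ℤ.+ v

      resonant? : ∀ L v n → Dec (Resonant L v n)
      resonant? L v n = + L ℤD.∣? (+ (n ℕ.+ M₀) ℤ.+ v)

      spaced : ∀ {L} v k → 0 < k → k < L → ∀ n → Resonant L v n → ¬ Resonant L v (k ℕ.+ n)
      spaced v k 0<k k<L n = ∤-shift 0<k k<L
        (trans (cong (λ j → + j ℤ.+ v) (ℕP.+-assoc k n M₀)) (trans (cong (ℤ._+ v) (ℤP.pos-+ k (n ℕ.+ M₀)))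
            (ℤP.+-assoc (+ k) (+ (n ℕ.+ M₀)) v)))

      nonresonant : ∃ λ n → (zero ≢ m → ¬ Resonant (toℕ m) v₀ n) × (fromℕ d ≢ m → ¬ Resonant (d ℕ.∸ toℕ m) vₑ n)
      nonresonant = by-cases (zero FinP.≟ m) (fromℕ d FinP.≟ m)
        where
        by-cases : Dec (zero ≡ m) → Dec (fromℕ d ≡ m) →
          ∃ λ n → (zero ≢ m → ¬ Resonant (toℕ m) v₀ n) × (fromℕ d ≢ m → ¬ Resonant (d ℕ.∸ toℕ m) vₑ n)
        by-cases (yes 0≡m) (yes d≡m) = 0 , (λ 0≢m → contradiction 0≡m 0≢m) , (λ d≢m → contradiction d≡m d≢m)
        by-cases (no 0≢m) (yes d≡m) =
          let n , ¬r , _ = avoid-both {Q = λ _ → ⊥} (resonant? (toℕ m) v₀) (λ _ → no λ ())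
                (spaced v₀ 1 (s≤s z≤n) (proj₂ (left 0≢m))) (λ _ ()) (λ _ ())
          in n , (λ _ → ¬r) , (λ d≢m → contradiction d≡m d≢m)
        by-cases (yes 0≡m) (no d≢m) =
          let n , ¬r , _ = avoid-both {Q = λ _ → ⊥} (resonant? (d ℕ.∸ toℕ m) vₑ) (λ _ → no λ ())
                (spaced vₑ 1 (s≤s z≤n) (proj₂ (right d≢m))) (λ _ ()) (λ _ ())
          in n , (λ 0≢m → contradiction 0≡m 0≢m) , (λ _ → ¬r)
        by-cases (no 0≢m) (no d≢m) with not-both-2 0≢m d≢m
        ... | inj₁ 3≤m =
          let n , ¬r , ¬l = avoid-both (resonant? (d ℕ.∸ toℕ m) vₑ) (resonant? (toℕ m) v₀)
                (spaced vₑ 1 (s≤s z≤n) (proj₂ (right d≢m))) (spaced v₀ 1 (s≤s z≤n) (proj₂ (left 0≢m)))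
                    (spaced v₀ 2 (s≤s z≤n) 3≤m)
          in n , (λ _ → ¬l) , (λ _ → ¬r)
        ... | inj₂ 3≤d-m =
          let n , ¬l , ¬r = avoid-both (resonant? (toℕ m) v₀) (resonant? (d ℕ.∸ toℕ m) vₑ)
                (spaced v₀ 1 (s≤s z≤n) (proj₂ (left 0≢m))) (spaced vₑ 1 (s≤s z≤n) (proj₂ (right d≢m)))
                    (spaced vₑ 2 (s≤s z≤n) 3≤d-m)
          in n , (λ _ → ¬l) , (λ _ → ¬r)

      M = proj₁ nonresonant ℕ.+ M₀
      x = π (ℤ.- + M)

    large-last-move : ∃ λ v → v ≢ 0ℚ × Rootless (a [ m ]≔ v)
    large-last-move = x , nonzero , rootless-by-large-term (a [ m ]≔ x) m B M (ℕP.m≤n+m M₀ (proj₁ nonresonant))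
      (subst (Exact (ℤ.- + M)) (sym (VecP.lookup∘update m a x)) (Exact-π (ℤ.- + M)))
      others
      (λ 0≢m → record
        { v = v₀
        ; exactly = subst (Exact v₀) (sym (VecP.lookup∘update′ 0≢m a x))
            (proj₂ (valuation zero (λ e≢m → proj₁ (left e≢m))) 0≢m)
        ; v≤B = ℤP.≤-trans (i≤+∣i∣ v₀) (ℤ.+≤+ (ℕP.≤-trans (ℕP.m≤m+n ℤ.∣ v₀ ∣ ℤ.∣ vₑ ∣) (ℕP.m≤n+m _ B₀)))
        ; generic = proj₁ (proj₂ nonresonant) 0≢m })
      (λ d≢m → record
        { v = vₑ
        ; exactly = subst (Exact vₑ) (sym (VecP.lookup∘update′ d≢m a x))
            (proj₂ (valuation (fromℕ d) (λ e≢m → proj₁ (right e≢m))) d≢m)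
        ; v≤B = ℤP.≤-trans (i≤+∣i∣ vₑ) (ℤ.+≤+ (ℕP.≤-trans (ℕP.m≤n+m ℤ.∣ vₑ ∣ ℤ.∣ v₀ ∣) (ℕP.m≤n+m _ B₀)))
        ; generic = proj₂ (proj₂ nonresonant) d≢m })
      where
      nonzero : x ≢ 0ℚ
      nonzero e = Exact⇒⋠ (Exact-π (ℤ.- + M)) (i<suc[i] (ℤ.- + M)) (subst (ℤ.suc (ℤ.- + M) ≼_) (sym e) ≼-0)
      others : ∀ i → ℤ.- + B ≼ lookup (a [ m ]≔ x) i ⊎ i ≡ m
      others i with i FinP.≟ m
      ... | yes i≡m = inj₂ i≡m
      ... | no i≢m  = inj₁ (subst (ℤ.- + B ≼_) (sym (VecP.lookup∘update′ i≢m a x))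
        (≼-weaken (ℤP.neg-mono-≤ (ℤ.+≤+ (ℕP.m≤m+n B₀ _))) (proj₂ (uniform-lower-bound a) i)))

  -- Trinomials

  π-^ : ∀ s n → π s ^ n ≡ π (+ n ℤ.* s)
  π-^ s zero    = refl
  π-^ s (suc n) = trans (cong (π s *_) (π-^ s n)) (trans (sym (π-+ s (+ n ℤ.* s))) (cong π (sym (ℤP.suc-* (+ n) s))))

  residue-Unit : ∀ {u} → Unit u → ∃ λ r → p ℕD.∤ r × u ≡ₚ fromℕℚ r
  residue-Unit {u} unit = let r , _ , e = residue (Unit⇒Integral unit) in
    r , (λ p∣r → Exact⇒⋠ (Unit⇒Exact unit) (ℤ.+<+ (s≤s z≤n)) (subst (1ℤ ≼_)
      (solve 2 (λ u r → (u :- r) :+ r := u) refl u (fromℕℚ r)) (≼-+ (_≡ₚ_.congruent e) (multiple r p∣r)))) , e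
    where
    open +-*-Solver
    multiple : ∀ r → p ℕD.∣ r → 1ℤ ≼ fromℕℚ r
    multiple _ (ℕD.divides q refl) = subst (1ℤ ≼_)
      (trans (cong (λ k → fromℕℚ q * fromℕℚ k) (ℕP.*-identityʳ p)) (sym (fromℕℚ-* q p)))
      (≼-* (Integral⇒0≼ (fromℤ-integral (+ q))) (Exact⇒≼ (Exact-π 1ℤ)))

  -- The degree is `suc d` here and the last index `suc m`, positive by its form; `m<d` keeps it
  -- below the leading one.
  module _ {d : ℕ} (a : Vec ℚ (2 ℕ.+ d)) (m : Fin (suc d)) (m<d : toℕ m < d)
    {v₀ vₙ : ℤ} (exact₀ : Exact v₀ (lookup a zero)) (exactₙ : Exact vₙ (lookup a (suc (fromℕ d))))
    (sparse : ∀ i → i ≢ m → i ≢ fromℕ d → lookup a (suc i) ≡ 0ℚ) where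

    private
      m≢d : m ≢ fromℕ d
      m≢d refl = ℕP.<-irrefl (FinP.toℕ-fromℕ d) m<d

      module Choice (x : ℚ) where
        b = a [ suc m ]≔ x

        b₀≡a₀ : lookup b zero ≡ lookup a zero
        b₀≡a₀ = VecP.lookup∘update′ (λ ()) a x

        ex₀ : Exact v₀ (lookup b zero)
        ex₀ = subst (Exact v₀) (sym b₀≡a₀) exact₀

        bₙ≡aₙ : lookup b (suc (fromℕ d)) ≡ lookup a (suc (fromℕ d))
        bₙ≡aₙ = VecP.lookup∘update′ (λ e → m≢d (sym (FinP.suc-injective e))) a x

        exₙ : Exact vₙ (lookup b (suc (fromℕ d)))
        exₙ = subst (Exact vₙ) (sym bₙ≡aₙ) exactₙ

        term₀ : ∀ q → Exact v₀ (term b q zero)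
        term₀ q = subst (Exact v₀) (sym (term-0 b q)) ex₀

        termₙ : ∀ {q s} → Exact s q → Exact (vₙ ℤ.+ + suc d ℤ.* s) (term b q (suc (fromℕ d)))
        termₙ {q} {s} exs = subst (λ k → Exact (vₙ ℤ.+ + suc k ℤ.* s) (term b q (suc (fromℕ d)))) (FinP.toℕ-fromℕ d)
          (Exact-term b (suc (fromℕ d)) exₙ exs)

        termₘ : ∀ q → term b q (suc m) ≡ x * q ^ suc (toℕ m)
        termₘ q = term-update a q (suc m) x

        vanishing : ∀ q i → i ≢ m → i ≢ fromℕ d → term b q (suc i) ≡ 0ℚ
        vanishing q i i≢m i≢d = trans (term-update′ a q x (λ e → i≢m (FinP.suc-injective e)))
          (trans (cong (_* q ^ suc (toℕ i)) (sparse i i≢m i≢d)) (ℚP.*-zeroˡ (q ^ suc (toℕ i))))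

        lower : ∀ t q → t ≼ term b q (suc m) → ∀ i → i ≢ zero → i ≢ suc (fromℕ d) → t ≼ term b q i
        lower t q bₘ zero    0≢0 _ = contradiction refl 0≢0
        lower t q bₘ (suc i) _ i≢d with i FinP.≟ m
        ... | yes refl = bₘ
        ... | no i≢m   = subst (t ≼_) (sym (vanishing q i i≢m (λ e → i≢d (cong suc e)))) ≼-0

        first-dominates : ∀ q {t} → Exact t (term b q (suc (fromℕ d))) → v₀ ℤ.< t →
          ℤ.suc v₀ ≼ term b q (suc m) → Dominant b q
        first-dominates q {t} ext v₀<t bₘ = zero , v₀ , term₀ q , λ i i≢0 → smaller i i≢0 (i FinP.≟ suc (fromℕ d))
          where
          smaller : ∀ i → i ≢ zero → Dec (i ≡ suc (fromℕ d)) → ℤ.suc v₀ ≼ term b q i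
          smaller i i≢0 (yes refl) = ≼-weaken (ℤP.i<j⇒suc[i]≤j v₀<t) (Exact⇒≼ ext)
          smaller i i≢0 (no i≢d)   = lower _ q bₘ i i≢0 i≢d

        last-dominates : ∀ q {t} → Exact t (term b q (suc (fromℕ d))) → t ℤ.< v₀ →
          ℤ.suc t ≼ term b q (suc m) → Dominant b q
        last-dominates q {t} ext t<v₀ bₘ = suc (fromℕ d) , t , ext , λ i i≢d → smaller i i≢d (i FinP.≟ zero)
          where
          smaller : ∀ i → i ≢ suc (fromℕ d) → Dec (i ≡ zero) → ℤ.suc t ≼ term b q i
          smaller i i≢d (yes refl) = ≼-weaken (ℤP.i<j⇒suc[i]≤j t<v₀) (Exact⇒≼ (term₀ q))
          smaller i i≢d (no i≢0)   = lower _ q bₘ i i≢0 i≢d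

        three-terms : ∀ q → evalℚ b q ≡ term b q zero + (term b q (suc m) + term b q (suc (fromℕ d)))
        three-terms q = cong (λ s → term b q zero ℚ.+ s) (sum-pair (λ i → term b q (suc i)) m≢d (vanishing q))

      -- Only the two end terms survive, and a tie of them at s would read v₀ - vₙ = s (d + 1).
      zero-choice : ¬ (+ suc d ℤD.∣ v₀ ℤ.- vₙ) → Rootless (a [ suc m ]≔ 0ℚ)
      zero-choice ∤ = rootless-if-⋠ b ex₀ λ q s exs → dominant⇒⋠ b ex₀ q (dominant q s exs)
        where
        open Choice 0ℚ
        open ℤSolver.+-*-Solver
        termₘ≡0 : ∀ q → term b q (suc m) ≡ 0ℚ
        termₘ≡0 q = trans (termₘ q) (ℚP.*-zeroˡ (q ^ suc (toℕ m)))
        dominant : ∀ q s → Exact s q → Dominant b q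
        dominant q s exs with ℤP.<-cmp v₀ (vₙ ℤ.+ + suc d ℤ.* s)
        ... | tri< v₀<t _ _ = first-dominates q (termₙ exs) v₀<t (subst (ℤ.suc v₀ ≼_) (sym (termₘ≡0 q)) ≼-0)
        ... | tri> _ _ t<v₀ = last-dominates q (termₙ exs) t<v₀ (subst (_ ≼_) (sym (termₘ≡0 q)) ≼-0)
        ... | tri≈ _ e _ = contradiction (ℤD.divides s (trans (cong (ℤ._- vₙ) e)
          (solve 3 (λ v d s → v :+ d :* s :- v := s :* d) refl vₙ (+ suc d) s))) ∤

      u₀ = Exact.cofactor exact₀
      uₙ = Exact.cofactor exactₙ
      unit₀ = Exact.unit exact₀
      unitₙ = Exact.unit exactₙ

      -- The end terms tie at s = e. Substituting q = p^e u and dividing by p^v₀ turns them into u₀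
      -- and uₙ u^(d+1) with unit coefficients; the power of p in `choice` turns the middle one into
      -- t u^(m+1). For a unit u, the value can then be read modulo p.
      module Rescaled (e : ℤ) (eq : v₀ ℤ.- vₙ ≡ e ℤ.* + suc d)
        (C A t : ℕ) (u₀≡C : u₀ ≡ₚ fromℕℚ C) (uₙ≡A : uₙ ≡ₚ fromℕℚ A)
        (missed : ∀ r → r < p → p ℕD.∤ (C ℕ.+ (t ℕ.* r ℕ.^ suc (toℕ m) ℕ.+ A ℕ.* r ℕ.^ suc d))) where

        choice : ℚ
        choice = π (v₀ ℤ.- + suc (toℕ m) ℤ.* e) * fromℕℚ t

        open Choice choice

        -- Only a lower bound is available, since t may be zero.
        termₘ-bound : ∀ {q s} → Exact s q → v₀ ℤ.+ + suc (toℕ m) ℤ.* (s ℤ.- e) ≼ term b q (suc m)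
        termₘ-bound {q} {s} exs = subst (_≼ term b q (suc m)) exponent
          (subst (v₀ ℤ.- μ ℤ.* e ℤ.+ μ ℤ.* s ≼_) (sym (termₘ q))
            (≼-* {x = choice} choice-bound (Exact⇒≼ (Exact-^ (suc (toℕ m)) exs))))
          where
          open ℤSolver.+-*-Solver
          μ = + suc (toℕ m)
          choice-bound : v₀ ℤ.- μ ℤ.* e ≼ choice
          choice-bound = mk≼ (fromℕℚ t) (fromℤ-integral (+ t)) refl
          exponent : v₀ ℤ.- μ ℤ.* e ℤ.+ μ ℤ.* s ≡ v₀ ℤ.+ μ ℤ.* (s ℤ.- e)
          exponent = solve 4 (λ v m e s → v :- m :* e :+ m :* s := v :+ m :* (s :- e)) refl v₀ μ e s

        vₙ+ds : ∀ s → vₙ ℤ.+ + suc d ℤ.* s ≡ v₀ ℤ.+ + suc d ℤ.* (s ℤ.- e)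
        vₙ+ds s = begin
          vₙ ℤ.+ + suc d ℤ.* s
            ≡⟨ solve 5 (λ v₀ vₙ d s e → vₙ :+ d :* s := v₀ :+ d :* (s :- e) :- ((v₀ :- vₙ) :- e :* d)) refl v₀
                vₙ (+ suc d) s e ⟩
          v₀ ℤ.+ + suc d ℤ.* (s ℤ.- e) ℤ.- ((v₀ ℤ.- vₙ) ℤ.- e ℤ.* + suc d)
            ≡⟨ cong (λ z → v₀ ℤ.+ + suc d ℤ.* (s ℤ.- e) ℤ.- (z ℤ.- e ℤ.* + suc d)) eq ⟩
          v₀ ℤ.+ + suc d ℤ.* (s ℤ.- e) ℤ.- (e ℤ.* + suc d ℤ.- e ℤ.* + suc d)
            ≡⟨ solve 2 (λ x y → x :- (y :- y) := x) refl (v₀ ℤ.+ + suc d ℤ.* (s ℤ.- e)) (e ℤ.* + suc d) ⟩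
          v₀ ℤ.+ + suc d ℤ.* (s ℤ.- e) ∎
          where
          open ≡-Reasoning
          open ℤSolver.+-*-Solver

        at-unit : ∀ {u} → Unit u → Exact 0ℤ (u₀ + (fromℕℚ t * u ^ suc (toℕ m) + uₙ * u ^ suc d))
        at-unit {u} unit = let r , r<p , e = residue iu in
          ≡ₚ-Unit (missed r r<p) (subst (value ≡ₚ_) (sym (homo r))
            (≡ₚ-+ u₀≡C (≡ₚ-+
              (≡ₚ-* (fromℤ-integral (+ t)) (fromℤ-integral (+ (r ℕ.^ suc (toℕ m)))) ≡ₚ-refl (≡ₚ-^ (suc (toℕ m)) iu e))
              (≡ₚ-* (Unit⇒Integral unitₙ) (fromℤ-integral (+ (r ℕ.^ suc d))) uₙ≡A (≡ₚ-^ (suc d) iu e)))))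
          where
          iu = Unit⇒Integral unit
          value = u₀ + (fromℕℚ t * u ^ suc (toℕ m) + uₙ * u ^ suc d)
          homo : ∀ r → fromℕℚ (C ℕ.+ (t ℕ.* r ℕ.^ suc (toℕ m) ℕ.+ A ℕ.* r ℕ.^ suc d)) ≡
            fromℕℚ C + (fromℕℚ t * fromℕℚ (r ℕ.^ suc (toℕ m)) + fromℕℚ A * fromℕℚ (r ℕ.^ suc d))
          homo r = trans (fromℕℚ-+ C (t ℕ.* r ℕ.^ suc (toℕ m) ℕ.+ A ℕ.* r ℕ.^ suc d)) (cong (λ z → fromℕℚ C ℚ.+ z)
            (trans (fromℕℚ-+ (t ℕ.* r ℕ.^ suc (toℕ m)) (A ℕ.* r ℕ.^ suc d))
                (cong₂ ℚ._+_ (fromℕℚ-* t (r ℕ.^ suc (toℕ m))) (fromℕℚ-* A (r ℕ.^ suc d)))))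

        rescale : ∀ {q u} → q ≡ π e * u →
          evalℚ b q ≡ π v₀ * (u₀ + (fromℕℚ t * u ^ suc (toℕ m) + uₙ * u ^ suc d))
        rescale {q} {u} refl = begin
          evalℚ b q
            ≡⟨ three-terms q ⟩
          term b q zero + (term b q (suc m) + term b q (suc (fromℕ d)))
            ≡⟨ cong₂ _+_ constant (cong₂ _+_ middle leading) ⟩
          π v₀ * u₀ + (π v₀ * (fromℕℚ t * u ^ suc (toℕ m)) + π v₀ * (uₙ * u ^ suc d))
            ≡⟨ solve 4 (λ k x y z → k :* x :+ (k :* y :+ k :* z) := k :* (x :+ (y :+ z))) refl
                 (π v₀) u₀ (fromℕℚ t * u ^ suc (toℕ m)) (uₙ * u ^ suc d) ⟩
          π v₀ * (u₀ + (fromℕℚ t * u ^ suc (toℕ m) + uₙ * u ^ suc d)) ∎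
          where
          open ≡-Reasoning
          open +-*-Solver
          module ℤS = ℤSolver.+-*-Solver
          power : ∀ k → q ^ k ≡ π (+ k ℤ.* e) * u ^ k
          power k = trans (^-distrib-* (π e) u k) (cong (_* u ^ k) (π-^ e k))
          combine : ∀ i j k w → i ℤ.+ j ≡ v₀ → π i * w * (π j * k) ≡ π v₀ * (w * k)
          combine i j k w i+j = trans (solve 4 (λ a w b k → a :* w :* (b :* k) := a :* b :* (w :* k)) refl (π i)
              w (π j) k)
            (cong (_* (w * k)) (trans (sym (π-+ i j)) (cong π i+j)))
          constant : term b q zero ≡ π v₀ * u₀
          constant = trans (term-0 b q) (trans b₀≡a₀ (Exact.equation exact₀))
          middle : term b q (suc m) ≡ π v₀ * (fromℕℚ t * u ^ suc (toℕ m))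
          middle = trans (termₘ q) (trans (cong (choice *_) (power (suc (toℕ m))))
            (combine (v₀ ℤ.- + suc (toℕ m) ℤ.* e) (+ suc (toℕ m) ℤ.* e) (u ^ suc (toℕ m)) (fromℕℚ t)
              (ℤS.solve 2 (λ v x → v ℤS.:- x ℤS.:+ x ℤS.:= v) refl v₀ (+ suc (toℕ m) ℤ.* e))))
          leading : term b q (suc (fromℕ d)) ≡ π v₀ * (uₙ * u ^ suc d)
          leading = begin
            lookup b (suc (fromℕ d)) * q ^ suc (toℕ (fromℕ d))
              ≡⟨ cong₂ (λ c k → c * q ^ suc k) (trans bₙ≡aₙ (Exact.equation exactₙ)) (FinP.toℕ-fromℕ d) ⟩
            π vₙ * uₙ * q ^ suc d
              ≡⟨ cong (π vₙ * uₙ *_) (power (suc d)) ⟩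
            π vₙ * uₙ * (π (+ suc d ℤ.* e) * u ^ suc d)
              ≡⟨ combine vₙ (+ suc d ℤ.* e) (u ^ suc d) uₙ (trans (vₙ+ds e)
                   (ℤS.solve 3 (λ v d e → v ℤS.:+ d ℤS.:* (e ℤS.:- e) ℤS.:= v) refl v₀ (+ suc d) e)) ⟩
            π v₀ * (uₙ * u ^ suc d) ∎

        rootless : Rootless b
        rootless = rootless-if-⋠ b ex₀ nonzero
          where
          nonzero : ∀ q s → Exact s q → ¬ (ℤ.suc v₀ ≼ evalℚ b q)
          -- At s = e all three terms may have the same valuation and the residue modulo p decides;
          -- on either side an end term dominates.
          nonzero q s exs with ℤP.<-cmp s e
          ... | tri≈ _ refl _ = Exact⇒⋠ (subst (Exact v₀) (sym (rescale (Exact.equation exs)))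
            (scale (at-unit (Exact.unit exs)))) (i<suc[i] v₀)
            where
            scale : ∀ {y} → Exact 0ℤ y → Exact v₀ (π v₀ * y)
            scale {y} ex = subst (λ i → Exact i (π v₀ * y)) (ℤP.+-identityʳ v₀) (Exact-* (Exact-π v₀) ex)
          ... | tri> _ _ e<s = dominant⇒⋠ b ex₀ q (first-dominates q (termₙ exs)
            (subst (v₀ ℤ.<_) (sym (vₙ+ds s)) (ℤP.suc[i]≤j⇒i<j (first-beats {+ suc d} {v₀} (ℤ.+≤+ (s≤s z≤n)) e<s)))
            (≼-weaken (first-beats {+ suc (toℕ m)} {v₀} (ℤ.+≤+ (s≤s z≤n)) e<s) (termₘ-bound exs)))
          ... | tri< s<e _ _ = dominant⇒⋠ b ex₀ q (last-dominates q
            (subst (λ i → Exact i (term b q (suc (fromℕ d)))) (vₙ+ds s) (termₙ exs))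
            (subst (v₀ ℤ.+ + suc d ℤ.* (s ℤ.- e) ℤ.<_) (ℤP.+-identityʳ v₀)
                (ℤP.suc[i]≤j⇒i<j (last-beats {0ℤ} {+ suc d} {v₀} (ℤ.+≤+ (s≤s z≤n)) s<e)))
            (≼-weaken (last-beats {+ suc (toℕ m)} {+ suc d} {v₀} (ℤ.+≤+ (s≤s m<d)) s<e) (termₘ-bound exs)))

    trinomial-last-move : ∃ λ x → Rootless (a [ suc m ]≔ x)
    trinomial-last-move with + suc d ℤD.∣? (v₀ ℤ.- vₙ)
    ... | no ∤ = 0ℚ , zero-choice ∤
    ... | yes (ℤD.divides e eq) =
      let C , p∤C , u₀≡C = residue-Unit unit₀
          A , _ , uₙ≡A   = residue-Unit unitₙ
          t , missed     = rootless-mod A C (suc (toℕ m)) (suc d) p∤C (s≤s z≤n) (s≤s z≤n)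
      in Rescaled.choice e eq C A t u₀≡C uₙ≡A missed , Rescaled.rootless e eq C A t u₀≡C uₙ≡A missed

-- Wanda's last coefficient

1^ : ∀ n → 1ℚ ^ n ≡ 1ℚ
1^ zero    = refl
1^ (suc n) = trans (ℚP.*-identityˡ (1ℚ ^ n)) (1^ n)

module WandaLast {p : ℕ} (isPrime : Prime p) where

  open Padic isPrime using (pow)
  open Valuation isPrime
  open Roots isPrime
  open Dominance isPrime
  open LastMoves isPrime

  Exact⇒≢0 : ∀ {s x} → Exact s x → x ≢ 0ℚ
  Exact⇒≢0 {s} ex refl = Exact⇒⋠ ex (i<suc[i] s) ≼-0

  -- Powers of an argument of nonnegative valuation cannot lower a valuation, so the bound is
  -- uniform in K.
  evalℚ-pow-bound : ∀ {n B} (a : Vec ℚ n) → (∀ i → ℤ.- + B ≼ lookup a i) → ∀ K → ℤ.- + B ≼ evalℚ a (pow K)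
  evalℚ-pow-bound {B = B} a b K = ≼-sum (term a (pow K)) λ i → ≼-weaken
    (≤-by (0≤* {+ toℕ i} {+ K} (ℤ.+≤+ z≤n) (ℤ.+≤+ z≤n)) (solve 2 (λ B x → B :+ x :- B := x) refl (ℤ.- + B)
        (+ toℕ i ℤ.* + K)))
    (≼-term a i (b i) (Exact-π (+ K)))
    where open ℤSolver.+-*-Solver

  -- If the constant coefficient is nonzero, it dominates once K is large. If it is zero, a factor
  -- p^K cancels and the remaining coefficients are treated in the same way.
  nonvanishing : ∀ {n} (a : Vec ℚ n) i → lookup a i ≢ 0ℚ → ∃ λ K₀ → ∀ K → K₀ ≤ K → evalℚ a (pow K) ≢ 0ℚ
  nonvanishing (c ∷ a) i aᵢ≢0 with c ℚP.≟ 0ℚ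
  nonvanishing (c ∷ a) zero    aᵢ≢0 | yes c≡0 = contradiction c≡0 aᵢ≢0
  nonvanishing (c ∷ a) (suc i) aᵢ≢0 | yes refl = let K₀ , f = nonvanishing a i aᵢ≢0 in
    K₀ , λ K K₀≤K e → f K K₀≤K (π-injective (+ K) (begin
      pow K * evalℚ a (pow K)        ≡⟨ sym (ℚP.+-identityˡ _) ⟩
      0ℚ + pow K * evalℚ a (pow K)   ≡⟨ sym (evalℚ-∷ 0ℚ a (pow K)) ⟩
      evalℚ (0ℚ ∷ a) (pow K)         ≡⟨ e ⟩
      0ℚ                             ≡⟨ sym (ℚP.*-zeroʳ (pow K)) ⟩
      pow K * 0ℚ                     ∎))
    where open ≡-Reasoning
  nonvanishing (c ∷ a) i aᵢ≢0 | no c≢0 =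
    let t , ex = exact c≢0
        B , b  = uniform-lower-bound a
    -- The rest of the sum has valuation at least K - B, which must exceed t.
    in suc ℤ.∣ t ∣ ℕ.+ B , λ K K₀≤K → Exact⇒≢0 (subst (Exact t) (sym (evalℚ-∷ c a (pow K)))
      (Exact-+ ex (≼-weaken (enough t B K K₀≤K) (≼-* (Exact⇒≼ (Exact-π (+ K))) (evalℚ-pow-bound a b K)))))
    where
    open ℤSolver.+-*-Solver
    enough : ∀ t B K → suc ℤ.∣ t ∣ ℕ.+ B ≤ K → ℤ.suc t ℤ.≤ + K ℤ.+ (ℤ.- + B)
    enough t B K K₀≤K = ≤-by (0≤+ (slack (i≤+∣i∣ t)) (slack (ℤ.+≤+ K₀≤K)))
      (solve 4 (λ t ∣t∣ B K → K :+ (:- B) :- (con 1ℤ :+ t) := (∣t∣ :- t) :+ (K :- (con 1ℤ :+ ∣t∣ :+ B))) refl t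
          (+ ℤ.∣ t ∣) (+ B) (+ K))

  rooted-last-move : ∀ {n} (a : Vec ℚ n) m → (∃ λ j → j ≢ m × lookup a j ≢ 0ℚ) →
    ∃ λ v → v ≢ 0ℚ × ∃ λ r → evalℚ (a [ m ]≔ v) (fromℕℚ r) ≡ 0ℚ
  rooted-last-move a m (j , j≢m , aⱼ≢0) = v , v≢0 , p ℕ.^ K , root
    where
    open ≡-Reasoning
    nv = nonvanishing (a [ m ]≔ 0ℚ) j (λ e → aⱼ≢0 (trans (sym (VecP.lookup∘update′ j≢m a 0ℚ)) e))
    K = proj₁ nv
    g = evalℚ (a [ m ]≔ 0ℚ) (pow K)
    w = 1/pow K ^ toℕ m
    v = - (g * w)
    w-inverse : w * pow K ^ toℕ m ≡ 1ℚ
    w-inverse = begin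
      w * pow K ^ toℕ m           ≡⟨ ℚP.*-comm w (pow K ^ toℕ m) ⟩
      pow K ^ toℕ m * w           ≡⟨ sym (^-distrib-* (pow K) (1/pow K) (toℕ m)) ⟩
      (pow K * 1/pow K) ^ toℕ m   ≡⟨ cong (_^ toℕ m) (pow-inverseʳ K) ⟩
      1ℚ ^ toℕ m                  ≡⟨ 1^ (toℕ m) ⟩
      1ℚ                          ∎
    root : evalℚ (a [ m ]≔ v) (pow K) ≡ 0ℚ
    root = begin
      evalℚ (a [ m ]≔ v) (pow K)             ≡⟨ evalℚ-update a (pow K) m v ⟩
      - (g * w) * pow K ^ toℕ m + g          ≡⟨ solve 3 (λ g w x → :- (g :* w) :* x :+ g := g :* (:- (w :* x))
          :+ g) refl g w (pow K ^ toℕ m) ⟩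
      g * (- (w * pow K ^ toℕ m)) + g        ≡⟨ cong (λ z → g * (- z) + g) w-inverse ⟩
      g * (- 1ℚ) + g                         ≡⟨ solve 1 (λ g → g :* (:- con 1ℚ) :+ g := con 0ℚ) refl g ⟩
      0ℚ                                     ∎
      where open +-*-Solver
    -- For v = 0 the root equation would say that g = 0, against the choice of K.
    v≢0 : v ≢ 0ℚ
    v≢0 v≡0 = proj₂ nv K ℕP.≤-refl (trans (cong (λ z → evalℚ (a [ m ]≔ z) (pow K)) (sym v≡0)) root)

-- Play

vacancies : ∀ {n} → Vec (Maybe ℚ) n → ℕ
vacancies []            = 0
vacancies (nothing ∷ b) = suc (vacancies b)
vacancies (just _ ∷ b)  = vacancies b

vacancies-replicate : ∀ n → vacancies (replicate n nothing) ≡ n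
vacancies-replicate zero    = refl
vacancies-replicate (suc n) = cong suc (vacancies-replicate n)

vacancies-fill : ∀ {n} (b : Vec (Maybe ℚ) n) i x → lookup b i ≡ nothing →
  vacancies b ≡ suc (vacancies (b [ i ]≔ just x))
vacancies-fill (nothing ∷ b) zero    x v = refl
vacancies-fill (nothing ∷ b) (suc i) x v = cong suc (vacancies-fill b i x v)
vacancies-fill (just _ ∷ b)  (suc i) x v = vacancies-fill b i x v

find-vacancy : ∀ {n} (b : Vec (Maybe ℚ) n) → vacancies b ≢ 0 → ∃ λ i → lookup b i ≡ nothing
find-vacancy []            nz = contradiction refl nz
find-vacancy (nothing ∷ b) nz = zero , refl
find-vacancy (just _ ∷ b)  nz = let i , v = find-vacancy b nz in suc i , v

-- The zeros are provisional: before the last move one vacancy is left, and that move overwrites it.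
complete : ∀ {n} → Vec (Maybe ℚ) n → Vec ℚ n
complete = map (fromMaybe 0ℚ)

full⇒complete : ∀ {n} (b : Vec (Maybe ℚ) n) → vacancies b ≡ 0 → b ≡ map just (complete b)
full⇒complete []           full = refl
full⇒complete (just x ∷ b) full = cong (just x ∷_) (full⇒complete b full)

vacant? : ∀ (x : Maybe ℚ) → Dec (x ≡ nothing)
vacant? nothing  = yes refl
vacant? (just _) = no λ ()

full⇒filled : ∀ {n} (b : Vec (Maybe ℚ) n) → vacancies b ≡ 0 → ∀ i → lookup b i ≢ nothing
full⇒filled (just _ ∷ b) full zero    ()
full⇒filled (just _ ∷ b) full (suc i) v = full⇒filled b full i v

only-vacancy : ∀ {n} (b : Vec (Maybe ℚ) n) {i} → vacancies b ≡ 1 → lookup b i ≡ nothing →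
  ∀ j → j ≢ i → lookup b j ≢ nothing
only-vacancy b {i} one v j j≢i e = full⇒filled (b [ i ]≔ just 0ℚ)
  (ℕP.suc-injective (trans (sym (vacancies-fill b i 0ℚ v)) one)) j (trans (VecP.lookup∘update′ j≢i b (just 0ℚ)) e)

filled⇒≡just : ∀ {n} (b : Vec (Maybe ℚ) n) i → lookup b i ≢ nothing → lookup b i ≡ just (lookup (complete b) i)
filled⇒≡just (nothing ∷ b) zero    f = contradiction refl f
filled⇒≡just (just _ ∷ b)  zero    f = refl
filled⇒≡just (_ ∷ b)       (suc i) f = filled⇒≡just b i f

module Play (d : ℕ) (first : Player) {ℓ : Level} (WandaWins : Pred (Vec ℚ (suc d)) ℓ) where

  open Game d first WandaWins
  open Move

  End : Fin (suc d) → Set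
  End i = i ≡ zero ⊎ i ≡ fromℕ d

  end? : ∀ i → Dec (End i)
  end? i = (i FinP.≟ zero) ⊎-dec (i FinP.≟ fromℕ d)

  -- The side conditions of a move are irrelevant fields; being decidable, they can be recomputed.
  move-vacant : ∀ {b} (m : Move b) → lookup b (index m) ≡ nothing
  move-vacant {b} (mkMove i _ v _) = recompute (vacant? (lookup b i)) v

  move-nonzero : ∀ {b} (m : Move b) → End (index m) → value m ≢ 0ℚ
  move-nonzero (mkMove i x _ nz) = recompute (end? i →-dec ¬? (x ℚP.≟ 0ℚ)) nz

  count-vacancies : ∀ {k b} → History k b → k ℕ.+ vacancies b ≡ suc d
  count-vacancies []                    = vacancies-replicate (suc d)
  count-vacancies (_▸_ {k} {b} h m) = trans (sym (ℕP.+-suc k (vacancies (play b m))))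
    (trans (cong (k ℕ.+_) (sym (vacancies-fill b (index m) (value m) (move-vacant m)))) (count-vacancies h))

  unfinished : ∀ {k b} → k ≤ d → History k b → vacancies b ≢ 0
  unfinished {k} k≤d h full = ℕP.<-irrefl (trans (sym (ℕP.+-identityʳ k))
      (trans (cong (k ℕ.+_) (sym full)) (count-vacancies h))) (s≤s k≤d)

  play-other : ∀ {b} (m : Move b) {j} → j ≢ index m → lookup (play b m) j ≡ lookup b j
  play-other {b} m j≢ = VecP.lookup∘update′ j≢ b (just (value m))

  play-index : ∀ {b} (m : Move b) → lookup (play b m) (index m) ≡ just (value m)
  play-index {b} m = VecP.lookup∘update (index m) b (just (value m))

  vacant-before : ∀ {b} (m : Move b) {j} → lookup (play b m) j ≡ nothing → lookup b j ≡ nothing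
  vacant-before m {j} v with j FinP.≟ index m
  ... | yes refl = contradiction (trans (sym (play-index m)) v) λ ()
  ... | no j≢i   = trans (sym (play-other m j≢i)) v

  end≢0 : ∀ {k b} → History k b → ∀ {e} → End e → lookup b e ≢ just 0ℚ
  end≢0 []      {e} end eq = contradiction (trans (sym (VecP.lookup-replicate e nothing)) eq) λ ()
  end≢0 (h ▸ m) {e} end eq with e FinP.≟ index m
  ... | yes refl = move-nonzero m end (MaybeP.just-injective (trans (sym (play-index m)) eq))
  ... | no e≢i   = end≢0 h end (trans (sym (play-other m e≢i)) eq)

  -- The strategies look at the board and at whether the move is the last one, not at the order of
  -- the earlier moves.
  module Positional (P : Player) (early last : ∀ b → vacancies b ≢ 0 → Move b) where

    strategy : Strategy P
    strategy {k} {b} k≤d _ h with k ℕP.≟ d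
    ... | yes _ = last b (unfinished k≤d h)
    ... | no _  = early b (unfinished k≤d h)

    follows-early : ∀ {k b} (h : History k b) (m : Move b) → Follows strategy (h ▸ m) → k < d → mover first k ≡ P →
      ∃ λ nz → m ≡ early b nz
    follows-early {k} h m (_ , eq) k<d turn with k ℕP.≟ d | eq (ℕP.<⇒≤ k<d) turn
    ... | yes refl | _ = contradiction k<d (ℕP.<-irrefl refl)
    ... | no _     | e = unfinished (ℕP.<⇒≤ k<d) h , e

    follows-last : ∀ {b} (h : History d b) (m : Move b) → Follows strategy (h ▸ m) → mover first d ≡ P →
      ∃ λ nz → m ≡ last b nz
    follows-last h m (_ , eq) turn with d ℕP.≟ d | eq ℕP.≤-refl turn
    ... | yes _  | e = unfinished ℕP.≤-refl h , e
    ... | no d≢d | _ = contradiction refl d≢d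

    winning : mover first d ≡ P →
      (∀ {b} (h : History d b) → Follows strategy h → ∀ nz →
        let m = last b nz in WonBy P (complete b [ index m ]≔ value m)) →
      Winning strategy
    winning turn won (_▸_ {b = b} h m) f with follows-last h m f turn
    ... | nz , refl = complete b [ index (last b nz) ]≔ value (last b nz) ,
      trans (full⇒complete (play b m) full) (cong (map just) (VecP.map-[]≔ (fromMaybe 0ℚ) b (index m))) ,
      won h (proj₁ f) nz
      where
      full : vacancies (play b m) ≡ 0
      full = ℕP.+-cancelˡ-≡ (suc d) (vacancies (play b m)) 0 (trans (count-vacancies (h ▸ m))
          (sym (ℕP.+-identityʳ (suc d))))

  one-left : ∀ {b} → History d b → vacancies b ≡ 1
  one-left {b} h = ℕP.+-cancelˡ-≡ d (vacancies b) 1 (trans (count-vacancies h) (sym (ℕP.+-comm d 1)))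

  end-coefficient : ∀ {b i e} → History d b → lookup b i ≡ nothing → End e → e ≢ i → lookup (complete b) e ≢ 0ℚ
  end-coefficient {b} {i} {e} h v end e≢i z = end≢0 h end
    (trans (filled⇒≡just b e (only-vacancy b (one-left h) v e e≢i)) (cong just z))

-- Wanda's strategy

module WandaStrategy {ℓ : Level} (n : ℕ) {p : ℕ} (isPrime : Prime p)
  (D : Subring (Padic.commutativeRing isPrime) ℓ) (first : Player) where

  d = suc n

  open Game d first (HasRootIn isPrime D)
  open Play d first (HasRootIn isPrime D)
  open Roots isPrime
  open WandaLast isPrime

  -- A strategy answers on every board, so the existence of another nonzero coefficient is decided,
  -- and 1 is the filler when there is none.
  winning-value : ∀ (a : Vec ℚ (suc d)) i → ∃ λ x → x ≢ 0ℚ ×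
    ((∃ λ j → j ≢ i × lookup a j ≢ 0ℚ) → HasRootIn isPrime D (a [ i ]≔ x))
  winning-value a i = by-cases (FinP.any? λ j → ¬? (j FinP.≟ i) ×-dec ¬? (lookup a j ℚP.≟ 0ℚ))
    where
    Other = ∃ λ j → j ≢ i × lookup a j ≢ 0ℚ
    by-cases : Dec Other → ∃ λ x → x ≢ 0ℚ × (Other → HasRootIn isPrime D (a [ i ]≔ x))
    by-cases (yes other) = let x , x≢0 , r , root = rooted-last-move a i other in
      x , x≢0 , λ _ → root⇒HasRoot D {a [ i ]≔ x} r root
    by-cases (no none)   = 1ℚ , (λ ()) , λ other → contradiction other none

  early last : ∀ b → vacancies b ≢ 0 → Move b
  early b nz = let i , v = find-vacancy b nz in mkMove i 1ℚ v λ _ ()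
  last b nz = let i , v = find-vacancy b nz
                  x , x≢0 , _ = winning-value (complete b) i in mkMove i x v λ _ → x≢0

  open Positional wanda early last

  wanda-wins : mover first d ≡ wanda → HasWinningStrategy wanda
  wanda-wins turn = strategy , winning turn λ {b} h f nz →
    let i , v = find-vacancy b nz in proj₂ (proj₂ (winning-value (complete b) i)) (other h v)
    where
    -- At least one of the two ends differs from the last vacancy, and the rules make its
    -- coefficient nonzero.
    other : ∀ {b i} → History d b → lookup b i ≡ nothing → ∃ λ j → j ≢ i × lookup (complete b) j ≢ 0ℚ
    other {b} {zero}  h v = fromℕ d , (λ ()) , end-coefficient h v (inj₂ refl) λ ()
    other {b} {suc i} h v = zero , (λ ()) , end-coefficient h v (inj₁ refl) λ ()

-- Applied with x and y the two ends: if both are among at most two indices of Wanda, none of hers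
-- is interior.
∈-short : ∀ {A : Set} {x y z : A} (S : List A) → length S ≤ 2 → x ∈ S → y ∈ S → x ≢ y → z ∈ S → z ≡ x ⊎ z ≡ y
∈-short (_ ∷ _ ∷ _ ∷ _) (s≤s (s≤s ()))
∈-short _ _ (here refl) (here refl) x≢y _ = contradiction refl x≢y
∈-short _ _ (here refl) (there (here refl)) x≢y (here refl) = inj₁ refl
∈-short _ _ (here refl) (there (here refl)) x≢y (there (here refl)) = inj₂ refl
∈-short _ _ (there (here refl)) (here refl) x≢y (here refl) = inj₂ refl
∈-short _ _ (there (here refl)) (here refl) x≢y (there (here refl)) = inj₁ refl
∈-short _ _ (there (here refl)) (there (here refl)) x≢y _ = contradiction refl x≢y

-- Nora's strategy

module NoraStrategy {ℓ : Level} (n : ℕ) {p : ℕ} (isPrime : Prime p)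
  (D : Subring (Padic.commutativeRing isPrime) ℓ) (first : Player) where

  d = 2 ℕ.+ n

  open Game d first (HasRootIn isPrime D)
  open Move
  open Play d first (HasRootIn isPrime D)
  open Valuation isPrime using (exact)
  open Roots isPrime
  open LastMoves isPrime

  second penultimate : Fin (suc d)
  second      = suc zero
  penultimate = suc (inject₁ (fromℕ n))

  toℕ-penultimate : toℕ penultimate ≡ suc n
  toℕ-penultimate = cong suc (trans (FinP.toℕ-inject₁ (fromℕ n)) (FinP.toℕ-fromℕ n))

  second-interior : ¬ End second
  second-interior (inj₁ ())
  second-interior (inj₂ ())

  penultimate-interior : ¬ End penultimate
  penultimate-interior (inj₁ ())
  penultimate-interior (inj₂ e) = ℕP.1+n≢n (sym (trans (sym toℕ-penultimate) (trans (cong toℕ e) (FinP.toℕ-fromℕ d))))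

  -- The order of priority is 1, d - 1, the other interior indices, the ends. The first two serve d
  -- ≥ 5, the postponement of the ends serves d ≤ 4.
  Preferred : Board → Fin (suc d) → Set
  Preferred b i = (lookup b second ≡ nothing → i ≡ second) ×
                  (lookup b penultimate ≡ nothing → i ≡ second ⊎ i ≡ penultimate) ×
                  (∀ j → ¬ End j → lookup b j ≡ nothing → ¬ End i)

  prefer : ∀ b → vacancies b ≢ 0 → ∃ λ i → lookup b i ≡ nothing × Preferred b i
  prefer b nz with vacant? (lookup b second)
  ... | yes v = second , v , (λ _ → refl) , (λ _ → inj₁ refl) , λ _ _ _ → second-interior
  ... | no ¬s with vacant? (lookup b penultimate)
  ... | yes v = penultimate , v , (λ s → contradiction s ¬s) , (λ _ → inj₂ refl) , λ _ _ _ → penultimate-interior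
  ... | no ¬p with FinP.any? (λ j → ¬? (end? j) ×-dec vacant? (lookup b j))
  ... | yes (j , inner , v) = j , v , (λ s → contradiction s ¬s) , (λ q → contradiction q ¬p) , λ _ _ _ → inner
  ... | no none = let i , v = find-vacancy b nz in
    i , v , (λ s → contradiction s ¬s) , (λ q → contradiction q ¬p) , λ j inner u → contradiction (j , inner , u) none

  early-value : Fin (suc d) → ℚ
  early-value i with end? i
  ... | yes _ = 1ℚ
  ... | no _  = 0ℚ

  early-value-end : ∀ i → End i → early-value i ≢ 0ℚ
  early-value-end i end with end? i
  ... | yes _    = λ ()
  ... | no inner = contradiction end inner

  early-value-interior : ∀ i → ¬ End i → early-value i ≡ 0ℚ
  early-value-interior i inner with end? i
  ... | yes end = contradiction end inner
  ... | no _    = refl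

  LargeTermWins : Vec ℚ (suc d) → Fin (suc d) → Set
  LargeTermWins a i =
    (zero ≢ i → lookup a zero ≢ 0ℚ × 2 ≤ toℕ i) ×
    (fromℕ d ≢ i → lookup a (fromℕ d) ≢ 0ℚ × 2 ≤ d ℕ.∸ toℕ i) ×
    (zero ≢ i → fromℕ d ≢ i → 3 ≤ toℕ i ⊎ 3 ≤ d ℕ.∸ toℕ i)

  TrinomialWins : Vec ℚ (suc d) → Fin (suc d) → Set
  TrinomialWins a i = ¬ End i × lookup a zero ≢ 0ℚ × lookup a (fromℕ d) ≢ 0ℚ ×
    (∀ j → j ≢ i → ¬ End j → lookup a j ≡ 0ℚ)

  large-term-wins? : ∀ a i → Dec (LargeTermWins a i)
  large-term-wins? a i =
    (¬? (zero FinP.≟ i) →-dec (¬? (lookup a zero ℚP.≟ 0ℚ) ×-dec (2 ℕP.≤? toℕ i))) ×-dec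
    (¬? (fromℕ d FinP.≟ i) →-dec (¬? (lookup a (fromℕ d) ℚP.≟ 0ℚ) ×-dec (2 ℕP.≤? (d ℕ.∸ toℕ i)))) ×-dec
    (¬? (zero FinP.≟ i) →-dec (¬? (fromℕ d FinP.≟ i) →-dec ((3 ℕP.≤? toℕ i) ⊎-dec (3 ℕP.≤? (d ℕ.∸ toℕ i)))))

  trinomial-wins? : ∀ a i → Dec (TrinomialWins a i)
  trinomial-wins? a i = ¬? (end? i) ×-dec ¬? (lookup a zero ℚP.≟ 0ℚ) ×-dec ¬? (lookup a (fromℕ d) ℚP.≟ 0ℚ) ×-dec
    FinP.all? (λ j → ¬? (j FinP.≟ i) →-dec (¬? (end? j) →-dec (lookup a j ℚP.≟ 0ℚ)))

  trinomial-value : ∀ a i → TrinomialWins a i → ∃ λ x → Rootless (a [ i ]≔ x)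
  trinomial-value a zero    (inner , _) = contradiction (inj₁ refl) inner
  trinomial-value a (suc m) (inner , a₀≢0 , aₙ≢0 , sparse) =
    trinomial-last-move a m m<d (proj₂ (exact a₀≢0)) (proj₂ (exact aₙ≢0))
      λ j j≢m j≢d → sparse (suc j) (λ e → j≢m (FinP.suc-injective e))
        λ { (inj₁ ()) ; (inj₂ e) → j≢d (FinP.suc-injective e) }
    where
    m<d : toℕ m < suc n
    m<d = ℕP.≤∧≢⇒< (FinP.toℕ≤pred[n] m) λ e → inner (inj₂ (cong suc
        (FinP.toℕ-injective (trans e (sym (FinP.toℕ-fromℕ (suc n)))))))

  -- Both criteria are decidable, so the last value can be computed from the board; 1 is a legal
  -- filler when neither holds.
  winning-value : ∀ a i → ∃ λ x → (End i → x ≢ 0ℚ) × (LargeTermWins a i ⊎ TrinomialWins a i → Rootless (a [ i ]≔ x))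
  winning-value a i = by-cases (large-term-wins? a i) (trinomial-wins? a i)
    where
    by-cases : Dec (LargeTermWins a i) → Dec (TrinomialWins a i) →
      ∃ λ x → (End i → x ≢ 0ℚ) × (LargeTermWins a i ⊎ TrinomialWins a i → Rootless (a [ i ]≔ x))
    by-cases (yes (l , r , lr)) _ =
      let x , x≢0 , rootless = large-last-move a i l r lr in x , (λ _ → x≢0) , λ _ → rootless
    by-cases (no _) (yes t@(inner , _)) =
      let x , rootless = trinomial-value a i t in x , (λ end → contradiction end inner) , λ _ → rootless
    by-cases (no ¬large) (no ¬trinomial) = 1ℚ , (λ _ ()) ,
      [ (λ l → contradiction l ¬large) , (λ t → contradiction t ¬trinomial) ]′

  early last : ∀ b → vacancies b ≢ 0 → Move b
  early b nz = let i , v , _ = prefer b nz in mkMove i (early-value i) v (early-value-end i)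
  last b nz = let i , v , _ = prefer b nz
                  x , nonzero , _ = winning-value (complete b) i in mkMove i x v nonzero

  open Positional nora early last

  stays-filled : ∀ {b} (m : Move b) {j} → lookup b j ≢ nothing → lookup (play b m) j ≢ nothing
  stays-filled m f v = f (vacant-before m v)

  follows-preferred : ∀ {k b} (h : History k b) (m : Move b) → Follows strategy (h ▸ m) →
    k < d → mover first k ≡ nora →
    Preferred b (index m) × (¬ End (index m) → value m ≡ 0ℚ)
  follows-preferred {b = b} h m f k<d turn = from-early (follows-early h m f k<d turn)
    where
    from-early : (∃ λ nz → m ≡ early b nz) → Preferred b (index m) × (¬ End (index m) → value m ≡ 0ℚ)
    from-early (nz , refl) = proj₂ (proj₂ (prefer b nz)) , early-value-interior (proj₁ (prefer b nz))

  chosen-filled : ∀ {b} (m : Move b) {j} → index m ≡ j → lookup (play b m) j ≢ nothing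
  chosen-filled m refl v = contradiction (trans (sym (play-index m)) v) λ ()

  plays-second : ∀ {k b} (h : History k b) (m : Move b) → Follows strategy (h ▸ m) → k < d → mover first k ≡ nora →
    lookup (play b m) second ≢ nothing
  plays-second h m f k<d turn v =
    chosen-filled m (proj₁ (proj₁ (follows-preferred h m f k<d turn)) (vacant-before m v)) v

  plays-penultimate : ∀ {k b} (h : History k b) (m : Move b) → Follows strategy (h ▸ m) →
    k < d → mover first k ≡ nora →
    lookup b second ≢ nothing → lookup (play b m) penultimate ≢ nothing
  plays-penultimate {b = b} h m f k<d turn filled v =
    [ (λ i≡second → filled (subst (λ j → lookup b j ≡ nothing) i≡second (move-vacant m)))
    , (λ i≡penultimate → chosen-filled m i≡penultimate v)
    ]′ (proj₁ (proj₂ (proj₁ (follows-preferred h m f k<d turn))) (vacant-before m v))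

  opponent-involutive : ∀ P → opponent (opponent P) ≡ P
  opponent-involutive nora  = refl
  opponent-involutive wanda = refl

  -- By parity both m₀ and m₂ are Nora's: after the first, index 1 is filled, and after the second,
  -- index d - 1.
  outer-interior-filled : ∀ {k b} (h : History (4 ℕ.+ k) b) → Follows strategy h → 4 ℕ.+ k ≤ d →
    mover first k ≡ nora →
    lookup b second ≢ nothing × lookup b penultimate ≢ nothing
  outer-interior-filled {k} (h ▸ m₀ ▸ m₁ ▸ m₂ ▸ m₃) ((((f , f₀) , f₁) , f₂) , f₃) 4+k≤d turn =
      stays-filled m₃ (stays-filled m₂ second₂) , stays-filled m₃
        (plays-penultimate (h ▸ m₀ ▸ m₁) m₂ (((f , f₀) , f₁) , f₂) (ℕP.≤-trans (ℕP.n≤1+n (3 ℕ.+ k)) 4+k≤d)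
            (trans (opponent-involutive (mover first k)) turn) second₂)
    where
    second₂ = stays-filled m₁ (plays-second h m₀ (f , f₀)
      (ℕP.≤-trans (ℕP.≤-trans (ℕP.n≤1+n (1 ℕ.+ k)) (ℕP.≤-trans (ℕP.n≤1+n (2 ℕ.+ k)) (ℕP.n≤1+n (3 ℕ.+ k))))
          4+k≤d) turn)

  count-wanda : Player → ℕ → ℕ
  count-wanda nora  k = k
  count-wanda wanda k = suc k

  moves-of-wanda : ℕ → ℕ
  moves-of-wanda zero    = 0
  moves-of-wanda (suc k) = count-wanda (mover first k) (moves-of-wanda k)

  -- Outside S, which collects Wanda's indices, only interior zeros have been placed.
  Tame : Board → List (Fin (suc d)) → Set
  Tame b S = ∀ j → j ∉ S → lookup b j ≡ nothing ⊎ (¬ End j × lookup b j ≡ just 0ℚ)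

  -- An interior index vacant now was vacant at every earlier move, so each of Nora's moves was
  -- interior and placed a zero.
  tame : ∀ {k b} (h : History k b) → Follows strategy h → k ≤ d → ∀ {i} → ¬ End i → lookup b i ≡ nothing →
    ∃ λ S → length S ≤ moves-of-wanda k × Tame b S
  tame []                  f k≤d inner v = [] , z≤n , λ j _ → inj₁ (VecP.lookup-replicate j nothing)
  tame (_▸_ {k} {b} h m) f k<d {i} inner v =
    by-mover (mover first k) refl (tame h (proj₁ f) (ℕP.<⇒≤ k<d) inner (vacant-before m v))
    where
    Outside : Fin (suc d) → Maybe ℚ → Set
    Outside j x = x ≡ nothing ⊎ (¬ End j × x ≡ just 0ℚ)
    by-mover : ∀ P → mover first k ≡ P → (∃ λ S → length S ≤ moves-of-wanda k × Tame b S) →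
      ∃ λ S → length S ≤ count-wanda P (moves-of-wanda k) × Tame (play b m) S
    by-mover wanda _ (S , short , t) = index m ∷ S , s≤s short , λ j j∉ →
      subst (Outside j) (sym (play-other m (λ e → j∉ (here e)))) (t j (λ j∈ → j∉ (there j∈)))
    by-mover nora turn (S , short , t) = S , short , λ j j∉ → outside j j∉ (j FinP.≟ index m)
      where
      preferred = follows-preferred h m f k<d turn
      interior : ¬ End (index m)
      interior = proj₂ (proj₂ (proj₁ preferred)) i inner (vacant-before m v)
      outside : ∀ j → j ∉ S → Dec (j ≡ index m) → Outside j (lookup (play b m) j)
      outside j j∉ (yes refl) = inj₂ (interior , trans (play-index m) (cong just (proj₂ preferred interior)))
      outside j j∉ (no j≢i)   = subst (Outside j) (sym (play-other m j≢i)) (t j j∉)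

  moves-of-wanda≤2 : ∀ {k} → k ≤ 4 → moves-of-wanda k ≤ 2
  moves-of-wanda≤2 {k} k≤4 = subst (_≤ 2) (after≡moves k) (small k k≤4 first)
    where
    -- The count with the first player as an argument, so that it evaluates for either of the two.
    after : ℕ → Player → ℕ
    after zero    P = 0
    after (suc k) P = count-wanda (mover P k) (after k P)
    after≡moves : ∀ k → after k first ≡ moves-of-wanda k
    after≡moves zero    = refl
    after≡moves (suc k) = cong (count-wanda (mover first k)) (after≡moves k)
    small : ∀ k → k ≤ 4 → ∀ P → after k P ≤ 2
    small 0 _ _     = z≤n
    small 1 _ nora  = z≤n
    small 1 _ wanda = s≤s z≤n
    small 2 _ nora  = s≤s z≤n
    small 2 _ wanda = s≤s z≤n
    small 3 _ nora  = s≤s z≤n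
    small 3 _ wanda = s≤s (s≤s z≤n)
    small 4 _ nora  = s≤s (s≤s z≤n)
    small 4 _ wanda = s≤s (s≤s z≤n)
    small (suc (suc (suc (suc (suc _))))) (s≤s (s≤s (s≤s (s≤s ()))))

  module _ {b : Board} {i : Fin (suc d)} (full : ∀ j → j ≢ i → lookup b j ≢ nothing)
    (a₀≢0 : zero ≢ i → lookup (complete b) zero ≢ 0ℚ) (aₙ≢0 : fromℕ d ≢ i → lookup (complete b) (fromℕ d) ≢ 0ℚ)
    (v : lookup b i ≡ nothing) where

    end-wins : End i → LargeTermWins (complete b) i
    end-wins (inj₁ refl) =
        (λ 0≢0 → contradiction refl 0≢0)
      , (λ d≢0 → aₙ≢0 d≢0 , s≤s (s≤s z≤n))
      , (λ 0≢0 → contradiction refl 0≢0)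
    end-wins (inj₂ refl) =
        (λ 0≢d → a₀≢0 0≢d , s≤s (s≤s z≤n))
      , (λ d≢d → contradiction refl d≢d)
      , (λ _ d≢d → contradiction refl d≢d)

    -- Without 0, 1, d - 1 and d there remains 2 ≤ i ≤ d - 2 = n. If i ≤ 2, then d - i ≥ n ≥ 3, so
    -- one of the distances is at least 3.
    high-degree-wins : ¬ End i → 3 ≤ n → i ≢ second → i ≢ penultimate → LargeTermWins (complete b) i
    high-degree-wins inner 3≤n i≢s i≢p = (λ 0≢i → a₀≢0 0≢i , 2≤i) , (λ d≢i → aₙ≢0 d≢i , 2≤d-i) , λ _ _ → three
        (3 ℕP.≤? toℕ i)
      where
      2≤i : 2 ≤ toℕ i
      2≤i = ℕP.≤∧≢⇒< (ℕP.≤∧≢⇒< z≤n λ e → inner (inj₁ (FinP.toℕ-injective (sym e)))) λ e → i≢s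
          (FinP.toℕ-injective (sym e))
      i≤n : toℕ i ≤ n
      i≤n = ℕP.≤-pred (ℕP.≤∧≢⇒< (ℕP.≤-pred (ℕP.≤∧≢⇒< (FinP.toℕ≤pred[n] i)
        λ e → inner (inj₂ (FinP.toℕ-injective (trans e (sym (FinP.toℕ-fromℕ d)))))))
        λ e → i≢p (FinP.toℕ-injective (trans e (sym toℕ-penultimate))))
      2≤d-i : 2 ≤ d ℕ.∸ toℕ i
      2≤d-i = subst (_≤ d ℕ.∸ toℕ i) (ℕP.m+n∸n≡m 2 n) (ℕP.∸-monoʳ-≤ d i≤n)
      three : Dec (3 ≤ toℕ i) → 3 ≤ toℕ i ⊎ 3 ≤ d ℕ.∸ toℕ i
      three (yes 3≤i) = inj₁ 3≤i
      three (no 3≰i)  = inj₂ (ℕP.≤-trans 3≤n (ℕP.∸-monoʳ-≤ d (ℕP.≤-pred (ℕP.≰⇒> 3≰i))))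

    -- Both ends are filled, and a filled end cannot be one of Nora's interior zeros, so both lie in
    -- S. With at most two elements, S has no room for an interior index.
    low-degree-wins : ¬ End i → ∀ S → length S ≤ 2 → Tame b S → TrinomialWins (complete b) i
    low-degree-wins inner S short t = inner , a₀≢0 (λ e → inner (inj₁ (sym e))) , aₙ≢0 (λ e → inner (inj₂ (sym e))) ,
      λ j j≢i j-inner → zero-coefficient j j≢i j-inner (j ∈? S)
      where
      open DecMembership (FinP._≟_ {suc d}) using (_∈?_)
      end∈S : ∀ e → End e → Dec (e ∈ S) → e ∈ S
      end∈S e end (yes e∈S) = e∈S
      end∈S e end (no e∉S) = ⊥-elim ([ full e (λ { refl → inner end }) , (λ p → proj₁ p end) ]′ (t e e∉S))
      zero-coefficient : ∀ j → j ≢ i → ¬ End j → Dec (j ∈ S) → lookup (complete b) j ≡ 0ℚ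
      zero-coefficient j j≢i j-inner (yes j∈S) = contradiction
        (∈-short S short (end∈S zero (inj₁ refl) (zero ∈? S)) (end∈S (fromℕ d) (inj₂ refl) (fromℕ d ∈? S))
            (λ ()) j∈S) j-inner
      zero-coefficient j j≢i j-inner (no j∉S) =
        [ (λ e → contradiction e (full j j≢i))
        , (λ p → trans (VecP.lookup-map j (fromMaybe 0ℚ) b) (cong (fromMaybe 0ℚ) (proj₂ p))) ]′ (t j j∉S)

    -- The length k is kept apart from d so that the history can be matched four moves from its end;
    -- k > 4 means d ≥ 5.
    interior-wins : ∀ k → (h : History k b) → Follows strategy h → k ≡ d → mover first k ≡ nora → ¬ End i →
      LargeTermWins (complete b) i ⊎ TrinomialWins (complete b) i
    interior-wins k h f k≡d turn inner = by-degree (k ℕP.≤? 4)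
      where
      high : ∀ k → 4 < k → (h : History k b) → Follows strategy h → k ≡ d → mover first k ≡ nora →
        LargeTermWins (complete b) i
      high (suc (suc (suc (suc k)))) (s≤s (s≤s (s≤s (s≤s 0<k)))) h f k≡d turn =
        let s-filled , p-filled = outer-interior-filled h f (ℕP.≤-reflexive k≡d) mover-k
        in high-degree-wins inner (subst (3 ≤_) (ℕP.suc-injective (ℕP.suc-injective k≡d)) (s≤s (s≤s 0<k)))
             (λ i≡s → s-filled (subst (λ j → lookup b j ≡ nothing) i≡s v))
             (λ i≡p → p-filled (subst (λ j → lookup b j ≡ nothing) i≡p v))
        where
        mover-k : mover first k ≡ nora
        mover-k = trans (sym (trans (opponent-involutive (opponent (opponent (mover first k))))
            (opponent-involutive (mover first k)))) turn
      by-degree : Dec (k ≤ 4) → LargeTermWins (complete b) i ⊎ TrinomialWins (complete b) i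
      by-degree (no k≰4)  = inj₁ (high k (ℕP.≰⇒> k≰4) h f k≡d turn)
      by-degree (yes k≤4) = let S , short , t = tame h f (ℕP.≤-reflexive k≡d) inner v in
        inj₂ (low-degree-wins inner S (ℕP.≤-trans short (moves-of-wanda≤2 k≤4)) t)

  nora-wins : mover first d ≡ nora → HasWinningStrategy nora
  nora-wins turn = strategy , winning turn λ {b} h f nz →
    let i , v , _    = prefer b nz
        x , _ , wins = winning-value (complete b) i
    in Rootless⇒¬HasRoot D {complete b [ i ]≔ x} (wins (last-index-wins h f v))
    where
    last-index-wins : ∀ {b i} → (h : History d b) → Follows strategy h → lookup b i ≡ nothing →
      LargeTermWins (complete b) i ⊎ TrinomialWins (complete b) i
    last-index-wins {b} {i} h f v = by-cases (end? i)
      where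
      full = only-vacancy b (one-left h) v
      a₀≢0 = end-coefficient h v (inj₁ refl)
      aₙ≢0 = end-coefficient h v (inj₂ refl)
      by-cases : Dec (End i) → LargeTermWins (complete b) i ⊎ TrinomialWins (complete b) i
      by-cases (yes end)  = inj₁ (end-wins {b} full a₀≢0 aₙ≢0 v end)
      by-cases (no inner) = interior-wins {b} full a₀≢0 aₙ≢0 v d h f refl turn inner

theorem2 : ∀ {ℓ : Level} (d p : ℕ) → 1 < d → (isPrime : Prime p) →
    (D₂ : Subring (Padic.commutativeRing isPrime) ℓ) (first : Player) →
    Game.HasWinningStrategy d first (HasRootIn isPrime D₂) (lastMover d first)
theorem2 (suc (suc n)) p (s≤s (s≤s z≤n)) isPrime D₂ first = by-last-mover (mover first (2 ℕ.+ n)) refl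
  where
  by-last-mover : ∀ P → mover first (2 ℕ.+ n) ≡ P → Game.HasWinningStrategy (2 ℕ.+ n) first (HasRootIn isPrime D₂) P
  by-last-mover nora  = NoraStrategy.nora-wins n isPrime D₂ first
  by-last-mover wanda = WandaStrategy.wanda-wins (suc n) isPrime D₂ first
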